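{- A monounary algebra is ultrahomogeneous if and only if it is isomorphic to $$\beta\cdot\mathcal{B}_\alpha+\sum_{k\in\mathbb{N}}\beta_k\cdot\mathcal{A}[n_k;\alpha_0^k,\alpha_1^k,\dots]$$ for some distinct $n_1,n_2,\dots\in\mathbb{N}$, some cardinals $\beta,\beta_k$ $(k\in\mathbb{N})$ (possibly zero), some nonzero cardinal $\alpha$, and, for each $k\in\mathbb{N}$, some (possibly finite, possibly empty) countable list of nonzero cardinals $\alpha_0^k,\alpha_1^k,\dots$.
   Context: A monounary algebra is a pair $\mathcal{A}=(A;\theta)$ where $A$ is a nonempty set (of arbitrary cardinality) and $\theta\colon A\to A$. It is connected if for all $x,y\in A$ there are $n,m\geq 0$ with $\theta^n(x)=\theta^m(y)$. Subalgebras are nonempty subsets closed under $\theta$; isomorphisms are bijections commuting with the operations. $\mathcal{A}$ is ultrahomogeneous if every isomorphism between finitely generated subalgebras of $\mathcal{A}$ extends to an automorphism of $\mathcal{A}$. $\mathbb{N}=\{1,2,\dots\}$. Sums $+,\sum$ denote disjoint unions of monounary algebras, and for a cardinal $\beta$, $\beta\cdot\mathcal{C}$ is the disjoint union of $\beta$ copies of $\mathcal{C}$ (empty if $\beta=0$). An element $x$ is cyclic if $\theta^n(x)=x$ for some $n\in\mathbb{N}$. The height $\mathrm{ht}(x)$ is the least $n\geq 0$ with $\theta^n(x)$ cyclic ($\infty$ if there is none). For a cardinal $\alpha>0$, $\mathcal{B}_\alpha$ denotes the (unique up to isomorphism) connected monounary algebra without cyclic elements in which $|\theta^{ -1}(x)|=\alpha$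 for every element $x$. For $n\in\mathbb{N}$ and a (possibly finite) countable list $\alpha_0,\alpha_1,\dots$ of nonzero cardinals, $\mathcal{A}[n;\alpha_0,\alpha_1,\dots]$ denotes the (unique up to isomorphism) connected monounary algebra whose set $C$ of cyclic elements has size $n$, with $|\theta^{ -1}(c)\setminus C|=\alpha_0$ for each $c\in C$, and $|\theta^{ -1}(x)|=\alpha_k$ for every $x$ with $\mathrm{ht}(x)=k>0$. If the list is finite, missing entries are read as $0$ (so with list $\alpha_0,\dots,\alpha_h$ the elements of height $h+1$ have no preimages, and with the empty list the algebra is just an $n$-cycle). -}

module Defs where

open import Data.Empty.Polymorphic using (⊥)
open import Data.Fin.Base using (Fin)
open import Data.List.Base using (List; []; _∷_)
open import Data.List.Membership.Propositional using (_∈_)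
open import Data.Nat.Base using (ℕ; zero; suc; _<_)
open import Data.Nat.GeneralisedArithmetic using (iterate)
open import Data.Product.Base using (Σ; ∃; ∃-syntax; _×_; _,_; proj₁; proj₂)
open import Data.Sum.Base using (_⊎_; map)
open import Function.Bundles using (Inverse; _↔_)
open import Level using (Level; _⊔_) renaming (suc to lsuc)
open import Relation.Binary.Bundles using (Setoid)
import Relation.Binary.Construct.On as On
open import Relation.Binary.PropositionalEquality using (_≡_; setoid)
open import Relation.Nullary.Negation using (¬_)
open import Relation.Unary using (Pred; _≐_)

private
  variable
    a b i ℓ p : Level

-- A set with a unary operation, possibly empty: disjoint unions, which may
-- have no summands, are formed here.
record Unary (ℓ : Level) : Set (lsuc ℓ) where
  field
    Carrier : Set ℓ
    θ       : Carrier → Carrier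

record MonounaryAlgebra (ℓ : Level) : Set (lsuc ℓ) where
  field
    unary : Unary ℓ

  open Unary unary public

  field
    nonempty : Carrier

record _≅_ (𝓐 : Unary a) (𝓑 : Unary b) : Set (a ⊔ b) where
  private
    module A = Unary 𝓐
    module B = Unary 𝓑
  field
    bijection : A.Carrier ↔ B.Carrier
  open Inverse bijection public using (to; from)
  field
    commutes : ∀ x → to (A.θ x) ≡ B.θ (to x)

infix 4 _≅_

_+_ : Unary ℓ → Unary ℓ → Unary ℓ
𝓐 + 𝓑 = record
  { Carrier = Unary.Carrier 𝓐 ⊎ Unary.Carrier 𝓑
  ; θ       = map (Unary.θ 𝓐) (Unary.θ 𝓑)
  }

∑ : {I : Set i} → (I → Unary ℓ) → Unary (i ⊔ ℓ)
∑ {I = I} 𝓕 = record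
  { Carrier = Σ I λ k → Unary.Carrier (𝓕 k)
  ; θ       = λ (k , x) → k , Unary.θ (𝓕 k) x
  }

-- Cardinals are represented by arbitrary types.
_·_ : Set ℓ → Unary ℓ → Unary ℓ
β · 𝓒 = ∑ {I = β} λ _ → 𝓒

infixl 6 _+_
infixl 7 _·_

-- The subset { x ∣ P x }: two elements are equal when they are equal in A,
-- whatever the proofs of P.
⟪_⟫ : {A : Set a} → Pred A p → Setoid (a ⊔ p) a
⟪_⟫ {A = A} P = On.setoid {B = ∃ P} (setoid A) proj₁

HasCardinality : {A : Set a} → Pred A p → Set b → Set (a ⊔ p ⊔ b)
HasCardinality P κ = Inverse ⟪ P ⟫ (setoid κ)

module _ (𝓐 : MonounaryAlgebra ℓ) where
  open MonounaryAlgebra 𝓐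

  Connected : Set ℓ
  Connected = ∀ x y → ∃[ n ] ∃[ m ] iterate θ x n ≡ iterate θ y m

  Cyclic : Pred Carrier ℓ
  Cyclic x = ∃[ n ] iterate θ x (suc n) ≡ x

  -- ht(x) = k for a finite k; an element of infinite height has no height
  -- in this sense.
  HasHeight : Carrier → ℕ → Set ℓ
  HasHeight x k = Cyclic (iterate θ x k) × (∀ j → j < k → ¬ Cyclic (iterate θ x j))

  Preimage : Carrier → Pred Carrier ℓ
  Preimage x y = θ y ≡ x

  NoncyclicPreimage : Carrier → Pred Carrier ℓ
  NoncyclicPreimage x y = Preimage x y × ¬ Cyclic y

  record Subalgebra : Set (lsuc ℓ) where
    field
      member    : Pred Carrier ℓ
      inhabited : ∃ member
      closed    : ∀ {x} → member x → member (θ x)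

    restrict : ∃ member → ∃ member
    restrict (x , x∈S) = θ x , closed x∈S

  open Subalgebra

  data Generated (gs : List Carrier) : Pred Carrier ℓ where
    generator : ∀ {x} → x ∈ gs → Generated gs x
    apply     : ∀ {x} → Generated gs x → Generated gs (θ x)

  FinitelyGenerated : Subalgebra → Set ℓ
  FinitelyGenerated S = ∃[ gs ] member S ≐ Generated gs

  record SubalgebraIsomorphism (S T : Subalgebra) : Set ℓ where
    field
      bijection : Inverse ⟪ member S ⟫ ⟪ member T ⟫
    open Inverse bijection public using (to)
    field
      commutes : ∀ s → proj₁ (to (restrict S s)) ≡ proj₁ (restrict T (to s))

  Ultrahomogeneous : Set (lsuc ℓ)
  Ultrahomogeneous =
    ∀ (S T : Subalgebra) → FinitelyGenerated S → FinitelyGenerated T →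
    (f : SubalgebraIsomorphism S T) →
    Σ (unary ≅ unary) λ g →
      ∀ s → _≅_.to g (proj₁ s) ≡ proj₁ (SubalgebraIsomorphism.to f s)

NonzeroCardinal : ∀ ℓ → Set (lsuc ℓ)
NonzeroCardinal ℓ = Σ (Set ℓ) λ κ → κ

data CardinalList (ℓ : Level) : Set (lsuc ℓ) where
  finite   : List (NonzeroCardinal ℓ) → CardinalList ℓ
  infinite : (ℕ → NonzeroCardinal ℓ) → CardinalList ℓ

-- Missing entries are read as zero.
entry : CardinalList ℓ → ℕ → Set ℓ
entry (finite [])       _       = ⊥
entry (finite (κ ∷ κs)) zero    = proj₁ κ
entry (finite (κ ∷ κs)) (suc k) = entry (finite κs) k
entry (infinite κs)     k       = proj₁ (κs k)

-- The algebras 𝓑_α and 𝓐[n; α₀, α₁, …] are given by the properties that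
-- determine them up to isomorphism.
record Is𝓑 (α : NonzeroCardinal ℓ) (𝓒 : MonounaryAlgebra ℓ) : Set ℓ where
  open MonounaryAlgebra 𝓒
  field
    connected : Connected 𝓒
    acyclic   : ∀ x → ¬ Cyclic 𝓒 x
    preimages : ∀ x → HasCardinality (Preimage 𝓒 x) (proj₁ α)

record Is𝓐[_⨾_] (n : ℕ) (αs : CardinalList ℓ) (𝓒 : MonounaryAlgebra ℓ) : Set ℓ where
  open MonounaryAlgebra 𝓒
  field
    connected       : Connected 𝓒
    cycle           : HasCardinality (Cyclic 𝓒) (Fin n)
    cyclicPreimages : ∀ c → Cyclic 𝓒 c →
                      HasCardinality (NoncyclicPreimage 𝓒 c) (entry αs 0)
    preimages       : ∀ x k → HasHeight 𝓒 x (suc k) →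
                      HasCardinality (Preimage 𝓒 x) (entry αs (suc k))

{-# OPTIONS --safe #-}
module Submission where

-- Call u and v similar when u ↦ v extends to an isomorphism between the
-- subalgebras they generate.  Everything rests on homogeneity: similar
-- elements have equally many noncyclic preimages.
--
-- An ultrahomogeneous algebra is homogeneous, because an automorphism carries u
-- to v.  Within a component all elements of equal height are similar, so each
-- component is some 𝓑_α or 𝓐[n; α₀, …]; components whose cycles have the same
-- length contain similar elements, so an automorphism makes them isomorphic.
--
-- Conversely, let f be an isomorphism between finitely generated subalgebras of
-- a sum of the stated form.  An element has finitely many preimages in the
-- domain of f, so by homogeneity f extends one level of preimages at a time,
-- until it is defined on whole components.  It meets finitely many components,
-- so its action on these extends to a permutation of all the components of
-- each kind, which moves the remaining ones.

open import Defs
import Algebra.Properties.AbelianGroup as AbelianGroup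
open import Axiom.ExcludedMiddle using (ExcludedMiddle)
open import Axiom.Extensionality.Propositional using (Extensionality)
open import Data.Bool.Base using (Bool; true)
open import Data.Empty.Polymorphic using (⊥)
import Data.Fin.Base as Fin
open import Data.Fin.Base using (Fin)
import Data.Fin.Properties as Fin
import Data.Integer.Base as ℤ
open import Data.Integer.Base using (ℤ; +_; -[1+_])
import Data.Integer.Properties as ℤ
open import Data.List.Base using (List; []; _∷_; map)
open import Data.List.Membership.Propositional using (_∈_)
open import Data.List.Membership.Propositional.Properties using (∈-map⁺)
open import Data.List.Relation.Unary.Any using (here; there)
open import Data.Maybe.Base using (Maybe; just; nothing; maybe)
import Data.Nat.Base as ℕ
open import Data.Nat.Base using (ℕ; zero; suc; NonZero; _<_; _≤_; z≤n; s≤s)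
import Data.Nat.DivMod as ℕ
open import Data.Nat.GeneralisedArithmetic using (iterate)
import Data.Nat.Properties as ℕ
open import Data.Product.Base using (Σ-syntax; ∃; ∃-syntax; _×_; _,_; proj₁; proj₂; swap)
open import Data.Sum.Base using (_⊎_; inj₁; inj₂)
open import Data.Unit.Polymorphic using (⊤; tt)
open import Function.Base using (_∘_; flip)
open import Function.Bundles using (_⇔_; _↔_; mk⇔; mk↔ₛ′; Inverse; Equivalence)
open import Function.Definitions using (Injective)
open import Function.Properties.Inverse using (↔-refl; ↔-sym; ↔-trans)
open import Level using (Level; _⊔_; Lift; lift; lower) renaming (suc to lsuc)
open import Relation.Binary.Definitions using (tri<; tri≈; tri>)
open import Relation.Binary.PropositionalEquality using (_≡_; _≢_; refl; sym; trans; cong; subst; module ≡-Reasoning)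
open import Relation.Binary.PropositionalEquality.WithK using (≡-irrelevant)
open import Relation.Nullary.Decidable using (yes; no; does; does-⇔; recompute; recompute-constant)
open import Relation.Nullary.Negation.Core using (¬_; contradiction)
open import Relation.Unary using (Pred; _≐_)

private
  variable
    a b c ℓ p q : Level
    A B : Set a

-- Iteration, and isomorphisms of sums.

iterate-suc : ∀ (f : A → A) x n → iterate f (f x) n ≡ f (iterate f x n)
iterate-suc f x zero    = refl
iterate-suc f x (suc n) = iterate-suc f (f x) n

iterate-+ : ∀ (f : A → A) x m n →
            iterate f x (m ℕ.+ n) ≡ iterate f (iterate f x m) n
iterate-+ f x zero    n = refl
iterate-+ f x (suc m) n = iterate-+ f (f x) m n

iterate-comm : ∀ (f : A → A) x m n →
               iterate f (iterate f x m) n ≡ iterate f (iterate f x n) m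
iterate-comm f x m n = begin
  iterate f (iterate f x m) n  ≡⟨ iterate-+ f x m n ⟨
  iterate f x (m ℕ.+ n)        ≡⟨ cong (iterate f x) (ℕ.+-comm m n) ⟩
  iterate f x (n ℕ.+ m)        ≡⟨ iterate-+ f x n m ⟩
  iterate f (iterate f x n) m  ∎
  where open ≡-Reasoning

iterate-homo : ∀ (f : A → A) (g : B → B) (h : A → B) →
               (∀ x → h (f x) ≡ g (h x)) →
               ∀ x n → h (iterate f x n) ≡ iterate g (h x) n
iterate-homo f g h homo x zero    = refl
iterate-homo f g h homo x (suc n) =
  trans (iterate-homo f g h homo (f x) n) (cong (λ y → iterate g y n) (homo x))

≅-sym : {𝓐 : Unary a} {𝓑 : Unary b} → 𝓐 ≅ 𝓑 → 𝓑 ≅ 𝓐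
≅-sym {𝓐 = 𝓐} {𝓑} φ = record
  { bijection = ↔-sym bijection
  ; commutes  = λ y → trans
      (cong (from ∘ Unary.θ 𝓑) (sym (Inverse.strictlyInverseˡ bijection y)))
      (trans (cong from (sym (commutes (from y)))) (Inverse.strictlyInverseʳ bijection _))
  }
  where open _≅_ φ

≅-trans : {𝓐 : Unary a} {𝓑 : Unary b} {𝓒 : Unary c} → 𝓐 ≅ 𝓑 → 𝓑 ≅ 𝓒 → 𝓐 ≅ 𝓒
≅-trans φ ψ = record
  { bijection = ↔-trans (_≅_.bijection φ) (_≅_.bijection ψ)
  ; commutes  = λ x → trans (cong (_≅_.to ψ) (_≅_.commutes φ x)) (_≅_.commutes ψ _)
  }

∑-cong : ∀ {i} {I : Set i} {𝓕 𝓖 : I → Unary ℓ} → (∀ i → 𝓕 i ≅ 𝓖 i) → ∑ 𝓕 ≅ ∑ 𝓖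
∑-cong φ = record
  { bijection = mk↔ₛ′
      (λ (i , x) → i , _≅_.to (φ i) x)
      (λ (i , x) → i , _≅_.from (φ i) x)
      (λ (i , x) → cong (i ,_) (Inverse.strictlyInverseˡ (_≅_.bijection (φ i)) x))
      (λ (i , x) → cong (i ,_) (Inverse.strictlyInverseʳ (_≅_.bijection (φ i)) x))
  ; commutes  = λ (i , x) → cong (i ,_) (_≅_.commutes (φ i) x)
  }

∑-Maybe : {𝓕 : Maybe ℕ → Unary ℓ} → ∑ 𝓕 ≅ 𝓕 nothing + ∑ (𝓕 ∘ just)
∑-Maybe = record
  { bijection = mk↔ₛ′
      (λ { (nothing , x) → inj₁ x ; (just k , x) → inj₂ (k , x) })
      (λ { (inj₁ x) → nothing , x ; (inj₂ (k , x)) → just k , x })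
      (λ { (inj₁ x) → refl ; (inj₂ (k , x)) → refl })
      (λ { (nothing , x) → refl ; (just k , x) → refl })
  ; commutes  = λ { (nothing , x) → refl ; (just k , x) → refl }
  }

-- Periodic points, heights and similarity.

Periodic : (A → A) → A → Set _
Periodic f x = ∃[ n ] iterate f x (suc n) ≡ x

FreshPreimage : (A → A) → A → A → Set _
FreshPreimage f x y = f y ≡ x × ¬ Periodic f y

Height : (A → A) → A → ℕ → Set _
Height f x k = Periodic f (iterate f x k) × (∀ j → j < k → ¬ Periodic f (iterate f x j))

periodic-apply : ∀ (f : A → A) {x} → Periodic f x → Periodic f (f x)
periodic-apply f {x} (n , eq) = n , trans (iterate-suc f (f x) n) (cong f eq)

periodic-iterate : ∀ (f : A → A) {x} k → Periodic f x → Periodic f (iterate f x k)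
periodic-iterate f zero    px = px
periodic-iterate f (suc k) px = periodic-iterate f k (periodic-apply f px)

-- Induction on `k` first returns to `f x`; the remaining `p` steps of the period lead from there to
-- `x`.
return : ∀ (f : A → A) {x} → Periodic f x → ∀ k → ∃[ n ] iterate f (iterate f x k) n ≡ x
return f {x} px        zero    = 0 , refl
return f {x} (p , eqₚ) (suc k) =
  let n , eq = return f (periodic-apply f (p , eqₚ)) k in
  n ℕ.+ p , (begin
    iterate f (iterate f (f x) k) (n ℕ.+ p)        ≡⟨ iterate-+ f _ n p ⟩
    iterate f (iterate f (iterate f (f x) k) n) p  ≡⟨ cong (λ y → iterate f y p) eq ⟩
    iterate f (f x) p                              ≡⟨ eqₚ ⟩
    x                                              ∎)
  where open ≡-Reasoning

collision⇒periodic : ∀ (f : A → A) x {m n} → m < n →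
                     iterate f x m ≡ iterate f x n → Periodic f (iterate f x m)
collision⇒periodic f x {m} {n} m<n eq = n ℕ.∸ suc m , (begin
  iterate f (iterate f x m) (suc (n ℕ.∸ suc m))  ≡⟨ iterate-+ f x m _ ⟨
  iterate f x (m ℕ.+ suc (n ℕ.∸ suc m))          ≡⟨ cong (iterate f x) (ℕ.+-suc m _) ⟩
  iterate f x (suc m ℕ.+ (n ℕ.∸ suc m))          ≡⟨ cong (iterate f x) (ℕ.m+[n∸m]≡n m<n) ⟩
  iterate f x n                                  ≡⟨ eq ⟨
  iterate f x m                                  ∎)
  where open ≡-Reasoning

-- The equation is a collision of the iterates `m + 1` and `n + 1`, so the iterate `m + 1` is
-- periodic. The iterate `n` comes no earlier, since `m < n`.
later-preimage-periodic : ∀ (f : A → A) x {m n} → m < n →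
                          f (iterate f x m) ≡ f (iterate f x n) → Periodic f (iterate f x n)
later-preimage-periodic f x {m} {n} m<n eq = subst (Periodic f)
  (trans (sym (iterate-+ f x (suc m) _)) (cong (iterate f x) (ℕ.m+[n∸m]≡n m<n)))
  (periodic-iterate f (n ℕ.∸ suc m)
    (collision⇒periodic f x (s≤s m<n)
      (trans (iterate-suc f x m) (trans eq (sym (iterate-suc f x n))))))

-- This is the source of finiteness: each generator contributes at most one nonperiodic preimage of
-- a given element, so a finitely generated subalgebra contains only finitely many.
orbit-preimage-unique : ∀ (f : A → A) x {m n} → f (iterate f x m) ≡ f (iterate f x n) →
                        ¬ Periodic f (iterate f x m) → ¬ Periodic f (iterate f x n) →
                        iterate f x m ≡ iterate f x n
orbit-preimage-unique f x {m} {n} eq ¬pm ¬pn with ℕ.<-cmp m n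
... | tri< m<n _ _  = contradiction (later-preimage-periodic f x m<n eq) ¬pn
... | tri≈ _ refl _ = refl
... | tri> _ _ n<m  = contradiction (later-preimage-periodic f x n<m (sym eq)) ¬pm

-- x ↦ y extends to an isomorphism between the subalgebras generated by x and y.
Similar : (A → A) → (B → B) → A → B → Set _
Similar f g x y = ∀ m n → iterate f x m ≡ iterate f x n ⇔ iterate g y m ≡ iterate g y n

module _ {f : A → A} {g : B → B} where

  similar-sym : ∀ {x y} → Similar f g x y → Similar g f y x
  similar-sym s m n = mk⇔ (Equivalence.from (s m n)) (Equivalence.to (s m n))

  similar-periodic : ∀ {x y} → Similar f g x y → Periodic f x → Periodic g y
  similar-periodic s (n , eq) = n , Equivalence.to (s (suc n) 0) eq

  similar-iterate : ∀ {x y} → Similar f g x y → ∀ k → Similar f g (iterate f x k) (iterate g y k)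
  similar-iterate {x} {y} s k m n = mk⇔
    (λ eq → trans (sym (iterate-+ g y k m))
              (trans (Equivalence.to (s (k ℕ.+ m) (k ℕ.+ n))
                 (trans (iterate-+ f x k m) (trans eq (sym (iterate-+ f x k n)))))
              (iterate-+ g y k n)))
    (λ eq → trans (sym (iterate-+ f x k m))
              (trans (Equivalence.from (s (k ℕ.+ m) (k ℕ.+ n))
                 (trans (iterate-+ g y k m) (trans eq (sym (iterate-+ g y k n)))))
              (iterate-+ f x k n)))

  -- Equations between iterates with both exponents positive concern only `f x` and `g y`; with
  -- exactly one exponent zero they would make `x` or `y` periodic.
  similar-preimage : ∀ {x y} → ¬ Periodic f x → ¬ Periodic g y →
                     Similar f g (f x) (g y) → Similar f g x y
  similar-preimage ¬px ¬py s zero    zero    = mk⇔ (λ _ → refl) (λ _ → refl)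
  similar-preimage ¬px ¬py s zero    (suc n) =
    mk⇔ (λ eq → contradiction (n , sym eq) ¬px) (λ eq → contradiction (n , sym eq) ¬py)
  similar-preimage ¬px ¬py s (suc m) zero    =
    mk⇔ (λ eq → contradiction (m , eq) ¬px) (λ eq → contradiction (m , eq) ¬py)
  similar-preimage ¬px ¬py s (suc m) (suc n) = s m n

  similar-height : ∀ {x y k} → Similar f g x y → Height f x k → Height g y k
  similar-height {k = k} s (per , below) =
    similar-periodic (similar-iterate s k) per ,
    λ j j<k → below j j<k ∘ similar-periodic⁻ j
    where
    similar-periodic⁻ : ∀ j → Periodic g _ → Periodic f _
    similar-periodic⁻ j (n , eq) = n , Equivalence.from (similar-iterate s j (suc n) 0) eq

similar-trans : ∀ {C : Set c} {f : A → A} {g : B → B} {h : C → C} {x y z} →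
                Similar f g x y → Similar g h y z → Similar f h x z
similar-trans s t m n = mk⇔ (Equivalence.to (t m n) ∘ Equivalence.to (s m n))
                            (Equivalence.from (s m n) ∘ Equivalence.from (t m n))

similar-embedding : ∀ {f : A → A} {g : B → B} (h : A → B) →
                    (∀ x → h (f x) ≡ g (h x)) → (∀ {x y} → h x ≡ h y → x ≡ y) →
                    ∀ x → Similar f g x (h x)
similar-embedding {f = f} {g} h homo inj x m n = mk⇔
  (λ eq → trans (sym (iterate-homo f g h homo x m)) (trans (cong h eq) (iterate-homo f g h homo x n)))
  (λ eq → inj (trans (iterate-homo f g h homo x m) (trans eq (sym (iterate-homo f g h homo x n)))))

-- Partial isomorphisms and their saturation.

-- A relation stands for the map so that its inverse is just the converse, and every argument about
-- domains can be reused for ranges.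
record PartialIso {A : Set a} (f : A → A) (G : A → A → Set p) : Set (a ⊔ p) where
  field
    functional : ∀ {x y z} → G x y → G x z → y ≡ z
    injective  : ∀ {x y z} → G x z → G y z → x ≡ y
    closed     : ∀ {x y} → G x y → G (f x) (f y)

  iterated : ∀ {x y} → G x y → ∀ n → G (iterate f x n) (iterate f y n)
  iterated g zero    = g
  iterated g (suc n) = iterated (closed g) n

  similar : ∀ {x y} → G x y → Similar f f x y
  similar {x} {y} g m n = mk⇔
    (λ eq → functional (iterated g m) (subst (λ z → G z (iterate f y n)) (sym eq) (iterated g n)))
    (λ eq → injective (iterated g m) (subst (G (iterate f x n)) (sym eq) (iterated g n)))

converse : {f : A → A} {G : A → A → Set p} → PartialIso f G → PartialIso f (flip G)
converse P = record { functional = injective ; injective = functional ; closed = closed }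
  where open PartialIso P

graph⇒≅ : {𝓐 : Unary a} {F : Unary.Carrier 𝓐 → Unary.Carrier 𝓐 → Set p} →
          PartialIso (Unary.θ 𝓐) F → (∀ x → ∃ (F x)) → (∀ y → ∃ (flip F y)) →
          Σ[ g ∈ 𝓐 ≅ 𝓐 ] (∀ {x y} → F x y → _≅_.to g x ≡ y)
graph⇒≅ P total cototal = record
  { bijection = mk↔ₛ′ (proj₁ ∘ total) (proj₁ ∘ cototal)
      (λ y → functional (proj₂ (total _)) (proj₂ (cototal y)))
      (λ x → injective (proj₂ (cototal _)) (proj₂ (total x)))
  ; commutes  = λ x → functional (proj₂ (total _)) (closed (proj₂ (total x)))
  } , λ h → functional (proj₂ (total _)) h
  where open PartialIso P

-- A choice, for every similar pair (f x , f y), of a bijection between the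
-- nonperiodic preimages; stated as a relation so that it can be reversed.
record Matching {A : Set a} (f : A → A) (G : A → A → Set p) (M : A → A → Set q) : Set (a ⊔ p ⊔ q) where
  field
    total       : ∀ {x y} → ¬ Periodic f x → Similar f f (f x) y → ∃[ z ] f z ≡ y × M x z
    cototal     : ∀ {x y} → ¬ Periodic f y → Similar f f (f y) x → ∃[ z ] f z ≡ x × M z y
    functional  : ∀ {x y z} → M x y → M x z → f y ≡ f z → y ≡ z
    injective   : ∀ {x y z} → M x z → M y z → f x ≡ f y → x ≡ y
    nonperiodic : ∀ {x y} → M x y → ¬ Periodic f x × ¬ Periodic f y
    extends     : ∀ {x y} → G x y → ¬ Periodic f x → ¬ Periodic f y → M x y

reverse : {f : A → A} {G : A → A → Set p} {M : A → A → Set q} →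
          Matching f G M → Matching f (flip G) (flip M)
reverse m = record
  { total       = cototal
  ; cototal     = total
  ; functional  = injective
  ; injective   = functional
  ; nonperiodic = λ mxy → let ¬px , ¬py = nonperiodic mxy in ¬py , ¬px
  ; extends     = λ g ¬px ¬py → extends g ¬py ¬px
  }
  where open Matching m

-- The negative premises of `step` make it incompatible with `base` at either end of a pair;
-- functionality and injectivity depend on this.
data Saturated {A : Set a} (f : A → A) (G : A → A → Set p) (M : A → A → Set q) :
               A → A → Set (a ⊔ p ⊔ q) where
  base : ∀ {x y} → G x y → Saturated f G M x y
  step : ∀ {x y} → Saturated f G M (f x) (f y) →
         ¬ ∃ (G x) → ¬ ∃ (flip G y) → M x y → Saturated f G M x y

saturated-flip : {f : A → A} {G : A → A → Set p} {M : A → A → Set q} {x y : A} →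
                 Saturated f G M x y → Saturated f (flip G) (flip M) y x
saturated-flip (base g)              = base g
saturated-flip (step e ∉dom ∉cod m)  = step (saturated-flip e) ∉cod ∉dom m

module _ {f : A → A} {G : A → A → Set p} {M : A → A → Set q}
         (P : PartialIso f G) (match : Matching f G M) where

  private
    module P = PartialIso P
    module M = Matching match

  saturated-similar : ∀ {x y} → Saturated f G M x y → Similar f f x y
  saturated-similar (base g)       = P.similar g
  saturated-similar (step e _ _ m) =
    let ¬px , ¬py = M.nonperiodic m in similar-preimage ¬px ¬py (saturated-similar e)

  saturated-functional : ∀ {x y z} → Saturated f G M x y → Saturated f G M x z → y ≡ z
  saturated-functional (base g) (base h)            = P.functional g h
  saturated-functional (base g) (step _ ∉dom _ _)   = contradiction (_ , g) ∉dom
  saturated-functional (step _ ∉dom _ _) (base h)   = contradiction (_ , h) ∉dom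
  -- By induction `y` and `z` have the same image under `f`, and `M` pairs `x` with at most one
  -- preimage of that image.
  saturated-functional (step d _ _ m) (step e _ _ n) =
    M.functional m n (saturated-functional d e)

  saturated-closed : ∀ {x y} → Saturated f G M x y → Saturated f G M (f x) (f y)
  saturated-closed (base g)       = base (P.closed g)
  saturated-closed (step e _ _ _) = e

saturated : {f : A → A} {G : A → A → Set p} {M : A → A → Set q} →
            PartialIso f G → Matching f G M → PartialIso f (Saturated f G M)
saturated P match = record
  { functional = saturated-functional P match
  -- Injectivity is functionality of the saturation of the converse.
  ; injective  = λ d e → saturated-functional (converse P) (reverse match)
                           (saturated-flip d) (saturated-flip e)
  ; closed     = saturated-closed P match
  }

-- Cardinalities of subsets.

hasCardinality-≐ : {P : Pred A p} {Q : Pred A q} {κ : Set b} →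
                   P ≐ Q → HasCardinality P κ → HasCardinality Q κ
hasCardinality-≐ (P⊆Q , Q⊆P) card = record
  { to        = λ (x , x∈Q) → to (x , Q⊆P x∈Q)
  ; from      = λ k → let x , x∈P = from k in x , P⊆Q x∈P
  ; to-cong   = to-cong
  ; from-cong = from-cong
  ; inverse   = inverseˡ , inverseʳ
  }
  where open Inverse card

-- The setoid `⟪ P ⟫` ignores proofs of `P`; once these are unique, its equality coincides with that
-- of `∃ P`.
hasCardinality⇒↔ : {P : Pred A p} {κ : Set b} → (∀ {x} (q r : P x) → q ≡ r) →
                   HasCardinality P κ → ∃ P ↔ κ
hasCardinality⇒↔ irr card = mk↔ₛ′ to from strictlyInverseˡ (λ x → ∃-≡ (strictlyInverseʳ x))
  where
  open Inverse card
  ∃-≡ : ∀ {x y} → proj₁ x ≡ proj₁ y → x ≡ y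
  ∃-≡ refl = cong (_ ,_) (irr _ _)

↔⇒hasCardinality : {P : Pred A p} {κ : Set b} → (∀ {x} (q r : P x) → q ≡ r) →
                   ∃ P ↔ κ → HasCardinality P κ
↔⇒hasCardinality irr h = record
  { to        = to
  ; from      = from
  ; to-cong   = to∘≡
  ; from-cong = λ { refl → refl }
  ; inverse   = (λ eq → trans (to∘≡ eq) (strictlyInverseˡ _))
              , (λ { refl → cong proj₁ (strictlyInverseʳ _) })
  }
  where
  open Inverse h
  to∘≡ : ∀ {x y} → proj₁ x ≡ proj₁ y → to x ≡ to y
  to∘≡ refl = cong (λ q → to (_ , q)) (irr _ _)

-- Least periods and residues.

-- The least period of x is k + 1.
Period : (A → A) → A → ℕ → Set _
Period f x k = iterate f x (suc k) ≡ x × (∀ j → j < k → iterate f x (suc j) ≢ x)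

module _ (f : A → A) {x : A} {k : ℕ} (period : Period f x k) where

  private
    multiple : ∀ q → iterate f x (q ℕ.* suc k) ≡ x
    multiple zero    = refl
    multiple (suc q) = trans (iterate-+ f x (suc k) (q ℕ.* suc k))
      (trans (cong (λ y → iterate f y (q ℕ.* suc k)) (proj₁ period)) (multiple q))

  iterate-mod : ∀ m → iterate f x m ≡ iterate f x (m ℕ.% suc k)
  iterate-mod m = begin
    iterate f x m                                        ≡⟨ cong (iterate f x) (ℕ.m≡m%n+[m/n]*n m (suc k)) ⟩
    iterate f x (m ℕ.% suc k ℕ.+ (m ℕ./ suc k) ℕ.* suc k)  ≡⟨ iterate-+ f x (m ℕ.% suc k) _ ⟩
    iterate f (iterate f x (m ℕ.% suc k)) ((m ℕ./ suc k) ℕ.* suc k)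
      ≡⟨ iterate-comm f x (m ℕ.% suc k) ((m ℕ./ suc k) ℕ.* suc k) ⟩
    iterate f (iterate f x ((m ℕ./ suc k) ℕ.* suc k)) (m ℕ.% suc k)
      ≡⟨ cong (λ y → iterate f y (m ℕ.% suc k)) (multiple (m ℕ./ suc k)) ⟩
    iterate f x (m ℕ.% suc k) ∎
    where open ≡-Reasoning

  private
    -- Applying `k + 1 - j` further steps to both sides turns the right one into `x`, so `x` would
    -- recur after `i + (k - j) + 1` steps, fewer than its least period.
    distinct : ∀ {i j} → i < j → j < suc k → iterate f x i ≢ iterate f x j
    distinct {i} {j} i<j (s≤s j≤k) eq = proj₂ period (i ℕ.+ (k ℕ.∸ j))
      (ℕ.<-≤-trans (ℕ.+-monoˡ-< (k ℕ.∸ j) i<j) (ℕ.≤-reflexive (ℕ.m+[n∸m]≡n j≤k)))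
      (begin
        iterate f x (suc (i ℕ.+ (k ℕ.∸ j)))        ≡⟨ cong (iterate f x) (ℕ.+-suc i _) ⟨
        iterate f x (i ℕ.+ suc (k ℕ.∸ j))          ≡⟨ iterate-+ f x i _ ⟩
        iterate f (iterate f x i) (suc (k ℕ.∸ j))  ≡⟨ cong (λ y → iterate f y (suc (k ℕ.∸ j))) eq ⟩
        iterate f (iterate f x j) (suc (k ℕ.∸ j))  ≡⟨ iterate-+ f x j _ ⟨
        iterate f x (j ℕ.+ suc (k ℕ.∸ j))          ≡⟨ cong (iterate f x) (ℕ.+-suc j _) ⟩
        iterate f x (suc (j ℕ.+ (k ℕ.∸ j)))        ≡⟨ cong (iterate f x ∘ suc) (ℕ.m+[n∸m]≡n j≤k) ⟩
        iterate f x (suc k)                        ≡⟨ proj₁ period ⟩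
        x                                          ∎)
      where open ≡-Reasoning

  iterate-≡⇒mod-≡ : ∀ m n → iterate f x m ≡ iterate f x n → m ℕ.% suc k ≡ n ℕ.% suc k
  iterate-≡⇒mod-≡ m n eq with ℕ.<-cmp (m ℕ.% suc k) (n ℕ.% suc k)
  ... | tri< lt _ _ = contradiction (trans (sym (iterate-mod m)) (trans eq (iterate-mod n)))
                        (distinct lt (ℕ.m%n<n n (suc k)))
  ... | tri≈ _ eq′ _ = eq′
  ... | tri> _ _ gt = contradiction (trans (sym (iterate-mod n)) (trans (sym eq) (iterate-mod m)))
                        (distinct gt (ℕ.m%n<n m (suc k)))

  mod-≡⇒iterate-≡ : ∀ m n → m ℕ.% suc k ≡ n ℕ.% suc k → iterate f x m ≡ iterate f x n
  mod-≡⇒iterate-≡ m n eq =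
    trans (iterate-mod m) (trans (cong (iterate f x) eq) (sym (iterate-mod n)))

-- On either side, equality of iterates means that `m` and `n` are congruent modulo `k + 1`.
period-similar : ∀ {f : A → A} {g : B → B} {x y k} → Period f x k → Period g y k → Similar f g x y
period-similar {f = f} {g} px py m n = mk⇔
  (mod-≡⇒iterate-≡ g py m n ∘ iterate-≡⇒mod-≡ f px m n)
  (mod-≡⇒iterate-≡ f px m n ∘ iterate-≡⇒mod-≡ g py m n)

NeverPeriodic : (A → A) → A → Set _
NeverPeriodic f x = ∀ n → ¬ Periodic f (iterate f x n)

neverPeriodic⇒injective : ∀ (f : A → A) {x} → NeverPeriodic f x → ∀ m n → iterate f x m ≡ iterate f x n → m ≡ n
neverPeriodic⇒injective f {x} np m n eq with ℕ.<-cmp m n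
... | tri< m<n _ _ = contradiction (collision⇒periodic f x m<n eq) (np m)
... | tri≈ _ m≡n _ = m≡n
... | tri> _ _ n<m = contradiction (collision⇒periodic f x n<m (sym eq)) (np n)

neverPeriodic-similar : ∀ {f : A → A} {g : B → B} {x y} →
                        NeverPeriodic f x → NeverPeriodic g y → Similar f g x y
neverPeriodic-similar {f = f} {g} {x} {y} nx ny m n = mk⇔
  (cong (iterate g y) ∘ neverPeriodic⇒injective f nx m n)
  (cong (iterate f x) ∘ neverPeriodic⇒injective g ny m n)

-- Connected algebras: heights and cycles.

module _ (𝓒 : MonounaryAlgebra ℓ) (connected : Connected 𝓒) where
  open MonounaryAlgebra 𝓒

  reach-periodic : ∀ {e} → Periodic θ e → ∀ x → ∃[ n ] iterate θ x n ≡ e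
  reach-periodic {e} periodic x =
    let u , v , eq = connected e x
        w , eq′    = return θ periodic u
    in v ℕ.+ w , trans (iterate-+ θ x v w) (trans (cong (λ z → iterate θ z w) (sym eq)) eq′)

  -- Of two cyclic elements each is an iterate of the other, and an equation between iterates of `u`
  -- passes to every iterate of `u`. Greater heights reduce to this by `similar-preimage`.
  height-similar : ∀ k {x y} → Height θ x k → Height θ y k → Similar θ θ x y
  height-similar zero {x} {y} (px , _) (py , _) m n = mk⇔ (transfer (reach-periodic py x)) (transfer (reach-periodic px y))
    where
    transfer : ∀ {u v} → ∃[ j ] iterate θ u j ≡ v → iterate θ u m ≡ iterate θ u n → iterate θ v m ≡ iterate θ v n
    transfer {u} (j , refl) eq =
      trans (iterate-comm θ u j m) (trans (cong (λ z → iterate θ z j) eq) (iterate-comm θ u n j))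
  height-similar (suc k) (px , belowx) (py , belowy) =
    similar-preimage (belowx 0 (s≤s z≤n)) (belowy 0 (s≤s z≤n))
      (height-similar k (px , λ j j<k → belowx (suc j) (s≤s j<k)) (py , λ j j<k → belowy (suc j) (s≤s j<k)))

  -- Every cyclic element is an iterate of `c`. The number of steps found may depend on the proof of
  -- periodicity, but its residue modulo `k + 1` does not.
  period⇒cycle : ∀ {c k} → Period θ c k → HasCardinality (Cyclic 𝓒) (Fin (suc k))
  period⇒cycle {c} {k} period = record
    { to        = λ e → remainder (steps e)
    ; from      = λ i → iterate θ c (Fin.toℕ i) , periodic-iterate θ (Fin.toℕ i) (k , proj₁ period)
    ; to-cong   = λ {x} {y} eq → remainder-≡ (steps x) (steps y)
                    (trans (iterate-steps x) (trans eq (sym (iterate-steps y))))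
    ; from-cong = cong (iterate θ c ∘ Fin.toℕ)
    ; inverse   = (λ {i} {x} eq → trans
                    (remainder-≡ (steps x) (Fin.toℕ i) (trans (iterate-steps x) eq))
                    (remainder-toℕ i))
                , (λ {x} eq → trans (cong (iterate θ c ∘ Fin.toℕ) eq)
                    (trans (cong (iterate θ c) (Fin.toℕ-fromℕ< (ℕ.m%n<n (steps x) (suc k))))
                      (trans (sym (iterate-mod θ period (steps x))) (iterate-steps x))))
    }
    where
    steps : ∃ (Cyclic 𝓒) → ℕ
    steps (_ , periodic) = proj₁ (reach-periodic periodic c)

    iterate-steps : ∀ x → iterate θ c (steps x) ≡ proj₁ x
    iterate-steps (_ , periodic) = proj₂ (reach-periodic periodic c)

    remainder : ℕ → Fin (suc k)
    remainder m = Fin.fromℕ< (ℕ.m%n<n m (suc k))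

    remainder-≡ : ∀ m n → iterate θ c m ≡ iterate θ c n → remainder m ≡ remainder n
    remainder-≡ m n eq = Fin.fromℕ<-cong _ _ (iterate-≡⇒mod-≡ θ period m n eq) _ _

    remainder-toℕ : ∀ i → remainder (Fin.toℕ i) ≡ i
    remainder-toℕ i = Fin.toℕ-injective
      (trans (Fin.toℕ-fromℕ< (ℕ.m%n<n (Fin.toℕ i) (suc k))) (ℕ.m<n⇒m%n≡m (Fin.toℕ<n i)))

module _ (𝓐 : MonounaryAlgebra a) (𝓑 : MonounaryAlgebra b) where
  private
    module A = MonounaryAlgebra 𝓐
    module B = MonounaryAlgebra 𝓑

  -- Some iterate of `x` lies on the cycle of `𝓐`, and every element of that cycle is an iterate of
  -- it. Similarity sends distinct iterates to distinct ones, so the first cycle injects into the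
  -- second.
  cycleLength-≤ : ∀ {m n x y} → Connected 𝓐 →
                  HasCardinality (Cyclic 𝓐) (Fin m) → HasCardinality (Cyclic 𝓑) (Fin n) →
                  ∃[ k ] Periodic A.θ (iterate A.θ x k) →
                  Similar A.θ B.θ x y → m ≤ n
  cycleLength-≤ {m} {n} {x} {y} connected cardA cardB (k , periodic) s = Fin.injective⇒≤ {f = f} f-injective
    where
    module CA = Inverse cardA
    module CB = Inverse cardB
    origin  = iterate A.θ x k
    origin′ = iterate B.θ y k

    origins-similar : Similar A.θ B.θ origin origin′
    origins-similar = similar-iterate s k

    reach : ∀ i → ∃[ j ] iterate A.θ origin j ≡ proj₁ (CA.from i)
    reach i = reach-periodic 𝓐 connected (proj₂ (CA.from i)) origin

    f : Fin m → Fin n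
    f i = CB.to (iterate B.θ origin′ (proj₁ (reach i)) ,
                 periodic-iterate B.θ (proj₁ (reach i)) (similar-periodic origins-similar periodic))

    f-injective : Injective _≡_ _≡_ f
    f-injective {i} {j} eq = begin
      i                 ≡⟨ CA.strictlyInverseˡ i ⟨
      CA.to (CA.from i) ≡⟨ CA.to-cong (trans (sym (proj₂ (reach i)))
                             (trans (Equivalence.from (origins-similar (proj₁ (reach i)) (proj₁ (reach j))) images-≡) (proj₂ (reach j)))) ⟩
      CA.to (CA.from j) ≡⟨ CA.strictlyInverseˡ j ⟩
      j                 ∎
      where
      open ≡-Reasoning
      images-≡ : iterate B.θ origin′ (proj₁ (reach i)) ≡ iterate B.θ origin′ (proj₁ (reach j))
      images-≡ = trans (sym (CB.strictlyInverseʳ _)) (trans (CB.from-cong eq) (CB.strictlyInverseʳ _))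

module _ {𝓒 : MonounaryAlgebra ℓ} where
  open MonounaryAlgebra 𝓒

  -- A periodic preimage would make `x` periodic. Hence counting noncyclic preimages treats the
  -- cycle and all greater heights uniformly.
  preimage≐fresh : ∀ {x} → ¬ Periodic θ x → Preimage 𝓒 x ≐ FreshPreimage θ x
  preimage≐fresh ¬px = (λ { refl → refl , ¬px ∘ periodic-apply θ }) , proj₁

  𝓑-fresh : ∀ {α} → Is𝓑 α 𝓒 → ∀ x → HasCardinality (FreshPreimage θ x) (proj₁ α)
  𝓑-fresh is𝓑 x = hasCardinality-≐ (preimage≐fresh (acyclic x)) (preimages x)
    where open Is𝓑 is𝓑

  𝓐-fresh : ∀ {n αs} → Is𝓐[ n ⨾ αs ] 𝓒 → ∀ {x k} → Height θ x k →
            HasCardinality (FreshPreimage θ x) (entry αs k)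
  𝓐-fresh is𝓐 {x} {zero}  (periodic , _) = Is𝓐[_⨾_].cyclicPreimages is𝓐 x periodic
  𝓐-fresh is𝓐 {x} {suc k} ht =
    hasCardinality-≐ (preimage≐fresh (proj₂ ht 0 (s≤s z≤n))) (Is𝓐[_⨾_].preimages is𝓐 x k ht)

  𝓐-eventuallyPeriodic : ∀ {n αs} .{{_ : NonZero n}} → Is𝓐[ n ⨾ αs ] 𝓒 →
                         ∀ x → ∃[ k ] Periodic θ (iterate θ x k)
  𝓐-eventuallyPeriodic {n = suc n} is𝓐 x =
    let c , periodic = Inverse.from cycle Fin.zero
        k , j , eq   = connected x c
    in k , subst (Periodic θ) (sym eq) (periodic-iterate θ j periodic)
    where open Is𝓐[_⨾_] is𝓐

orbit-generator : ∀ {𝓐 : MonounaryAlgebra a} {gs x} → Generated 𝓐 gs x →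
                  ∃[ g ] g ∈ gs × ∃[ n ] iterate (MonounaryAlgebra.θ 𝓐) g n ≡ x
orbit-generator (generator g∈) = _ , g∈ , 0 , refl
orbit-generator {𝓐 = 𝓐} (apply gen) =
  let g , g∈ , n , eq = orbit-generator gen
  in g , g∈ , suc n , trans (iterate-suc (MonounaryAlgebra.θ 𝓐) g n) (cong (MonounaryAlgebra.θ 𝓐) eq)

¬⇒↔⊥ : ¬ A → ⊥ {ℓ} ↔ A
¬⇒↔⊥ ¬x = mk↔ₛ′ (λ ()) (λ x → contradiction x ¬x) (λ x → contradiction x ¬x) (λ ())

-- Two standard examples: the integers and the finite cycles.

-- The algebras successor and rotation stand in for the kinds of component that
-- do not occur, which have multiplicity zero but must still be listed.
successor : ∀ ℓ → MonounaryAlgebra ℓ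
successor ℓ = record
  { unary    = record { Carrier = Lift ℓ ℤ ; θ = λ (lift z) → lift (ℤ.suc z) }
  ; nonempty = lift (+ 0)
  }

successor-is𝓑 : Is𝓑 (⊤ , tt) (successor ℓ)
successor-is𝓑 {ℓ} = record
  -- Both elements first rise to nonnegative integers `i` and `j`, and then by `j` and `i` more
  -- steps to `i + j`.
  { connected = λ x y → let m , i , eq = reachℕ x ; n , j , eq′ = reachℕ y in
      m ℕ.+ j , n ℕ.+ i , trans (iterate-+ θ x m j) (trans (cong (λ z → iterate θ z j) eq)
        (trans (iterate-pos i j) (trans (cong (lift ∘ +_) (ℕ.+-comm i j))
          (sym (trans (iterate-+ θ y n i) (trans (cong (λ z → iterate θ z i) eq′) (iterate-pos j i)))))))
  ; acyclic   = λ x (n , eq) → ascending x n eq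
  ; preimages = λ x → record
      { to        = λ _ → tt
      ; from      = λ _ → lift (ℤ.pred (lower x)) , cong lift (ℤ.suc-pred _)
      ; to-cong   = λ _ → refl
      ; from-cong = λ _ → refl
      ; inverse   = (λ _ → refl) , λ { {lift y , refl} _ → cong lift (ℤ.pred-suc y) }
      }
  }
  where
  open MonounaryAlgebra (successor ℓ)

  iterate-θ : ∀ z n → iterate θ (lift z) n ≡ lift (+ n ℤ.+ z)
  iterate-θ z zero    = cong lift (sym (ℤ.+-identityˡ z))
  iterate-θ z (suc n) = trans (iterate-suc θ (lift z) n)
    (trans (cong θ (iterate-θ z n)) (cong lift (sym (ℤ.+-assoc (+ 1) (+ n) z))))

  iterate-pos : ∀ i n → iterate θ (lift (+ i)) n ≡ lift (+ (i ℕ.+ n))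
  iterate-pos i n = trans (iterate-θ (+ i) n) (cong (lift ∘ +_) (ℕ.+-comm n i))

  reachℕ : ∀ x → ∃[ n ] ∃[ i ] iterate θ x n ≡ lift (+ i)
  reachℕ (lift (+ i))    = 0 , i , refl
  reachℕ (lift -[1+ i ]) = suc i , 0 , trans (iterate-θ -[1+ i ] (suc i)) (cong lift (ℤ.+-inverseʳ (+ suc i)))

  ascending : ∀ x n → iterate θ x (suc n) ≢ x
  -- Cancelling `z` would give `+ suc n ≡ + 0`.
  ascending (lift z) n eq with AbelianGroup.identityˡ-unique ℤ.+-0-abelianGroup (+ suc n) z
    (cong lower (trans (sym (iterate-θ z (suc n))) eq))
  ... | ()

rotation : ∀ ℓ → ℕ → MonounaryAlgebra ℓ
rotation ℓ k = record
  { unary    = record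
    { Carrier = Lift ℓ (Fin (suc k))
    ; θ       = λ (lift i) → lift (Fin.fromℕ< (ℕ.m%n<n (suc (Fin.toℕ i)) (suc k)))
    }
  ; nonempty = lift Fin.zero
  }

rotation-is𝓐 : ∀ k → Is𝓐[ suc k ⨾ finite [] ] (rotation ℓ k)
rotation-is𝓐 {ℓ} k = record
  -- The common iterate is the sum of `x` and `y` modulo `k + 1`.
  { connected       = λ x y → toℕ y , toℕ x , toℕ-injective (trans (iterate-θ x (toℕ y))
      (trans (cong (ℕ._% suc k) (ℕ.+-comm (toℕ x) (toℕ y))) (sym (iterate-θ y (toℕ x)))))
  ; cycle           = record
      { to        = λ (x , _) → lower x
      ; from      = λ i → lift i , periodic (lift i)
      ; to-cong   = cong lower
      ; from-cong = cong lift
      ; inverse   = cong lower , cong lift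
      }
  ; cyclicPreimages = λ _ _ → record
      { to        = λ (x , _ , ¬px) → contradiction (periodic x) ¬px
      ; from      = λ ()
      ; to-cong   = λ {(x , _ , ¬px)} → contradiction (periodic x) ¬px
      ; from-cong = λ {}
      ; inverse   = (λ { {()} }) , λ {(x , _ , ¬px)} → contradiction (periodic x) ¬px
      }
  ; preimages       = λ x _ (_ , below) → contradiction (periodic x) (below 0 (s≤s z≤n))
  }
  where
  open MonounaryAlgebra (rotation ℓ k)

  toℕ : Carrier → ℕ
  toℕ = Fin.toℕ ∘ lower

  toℕ-injective : ∀ {x y} → toℕ x ≡ toℕ y → x ≡ y
  toℕ-injective = cong lift ∘ Fin.toℕ-injective

  toℕ-% : ∀ x → toℕ x ℕ.% suc k ≡ toℕ x
  toℕ-% x = ℕ.m<n⇒m%n≡m (Fin.toℕ<n (lower x))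

  iterate-θ : ∀ x n → toℕ (iterate θ x n) ≡ (toℕ x ℕ.+ n) ℕ.% suc k
  iterate-θ x zero    = sym (trans (cong (ℕ._% suc k) (ℕ.+-identityʳ (toℕ x))) (toℕ-% x))
  iterate-θ x (suc n) = begin
    toℕ (iterate θ (θ x) n)                       ≡⟨ iterate-θ (θ x) n ⟩
    (toℕ (θ x) ℕ.+ n) ℕ.% suc k                   ≡⟨ cong (λ m → (m ℕ.+ n) ℕ.% suc k) (Fin.toℕ-fromℕ< (ℕ.m%n<n (suc (toℕ x)) (suc k))) ⟩
    (suc (toℕ x) ℕ.% suc k ℕ.+ n) ℕ.% suc k       ≡⟨ ℕ.%-distribˡ-+ (suc (toℕ x) ℕ.% suc k) n (suc k) ⟩
    (suc (toℕ x) ℕ.% suc k ℕ.% suc k ℕ.+ n ℕ.% suc k) ℕ.% suc k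
      ≡⟨ cong (λ m → (m ℕ.+ n ℕ.% suc k) ℕ.% suc k) (ℕ.m%n%n≡m%n (suc (toℕ x)) (suc k)) ⟩
    (suc (toℕ x) ℕ.% suc k ℕ.+ n ℕ.% suc k) ℕ.% suc k  ≡⟨ ℕ.%-distribˡ-+ (suc (toℕ x)) n (suc k) ⟨
    (suc (toℕ x) ℕ.+ n) ℕ.% suc k                 ≡⟨ cong (ℕ._% suc k) (ℕ.+-suc (toℕ x) n) ⟨
    (toℕ x ℕ.+ suc n) ℕ.% suc k                   ∎
    where open ≡-Reasoning

  periodic : ∀ x → Periodic θ x
  periodic x = k , toℕ-injective (trans (iterate-θ x (suc k))
    (trans (ℕ.[m+n]%n≡m%n (toℕ x) (suc k)) (toℕ-% x)))

module Classical (em : ∀ {a} → ExcludedMiddle a) (ext : ∀ {a b} → Extensionality a b) where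

  -- Extending finite partial injections.

  transposeAt : A → A → A → A
  transposeAt x y z with em {P = z ≡ x} | em {P = z ≡ y}
  ... | yes _ | _     = y
  ... | no _  | yes _ = x
  ... | no _  | no _  = z

  transposeAt-left : ∀ (x y : A) → transposeAt x y x ≡ y
  transposeAt-left x y with em {P = x ≡ x} | em {P = x ≡ y}
  ... | yes _ | _     = refl
  ... | no ≢  | _     = contradiction refl ≢

  transposeAt-right : ∀ (x y : A) → transposeAt x y y ≡ x
  transposeAt-right x y with em {P = y ≡ x} | em {P = y ≡ y}
  ... | yes eq | _     = eq
  ... | no _   | yes _ = refl
  ... | no _   | no ≢  = contradiction refl ≢

  transposeAt-other : ∀ {x y z : A} → z ≢ x → z ≢ y → transposeAt x y z ≡ z
  transposeAt-other {x = x} {y} {z} z≢x z≢y with em {P = z ≡ x} | em {P = z ≡ y}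
  ... | yes eq | _      = contradiction eq z≢x
  ... | no _   | yes eq = contradiction eq z≢y
  ... | no _   | no _   = refl

  transposeAt-involutive : ∀ (x y z : A) → transposeAt x y (transposeAt x y z) ≡ z
  transposeAt-involutive x y z with em {P = z ≡ x} | em {P = z ≡ y}
  ... | yes eq | _      = trans (transposeAt-right x y) (sym eq)
  ... | no _   | yes eq = trans (transposeAt-left x y) (sym eq)
  ... | no ≢x  | no ≢y  = transposeAt-other ≢x ≢y

  transpose : A → A → A ↔ A
  transpose x y = mk↔ₛ′ (transposeAt x y) (transposeAt x y)
                    (transposeAt-involutive x y) (transposeAt-involutive x y)

  module _ {X : Set a} {Y : Set b} (W : X → Y → Set p)
           (functional : ∀ {x y z} → W x y → W x z → y ≡ z)
           (injective : ∀ {x y z} → W x z → W y z → x ≡ y) where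

    -- Composing h with the transposition of h x and y corrects the value at x;
    -- injectivity of W keeps the values corrected before.
    extendInjection : X ↔ Y → (xs : List X) →
      Σ[ h ∈ X ↔ Y ] (∀ {x y} → x ∈ xs → W x y → Inverse.to h x ≡ y)
    extendInjection h []       = h , λ ()
    extendInjection h (x ∷ xs) with extendInjection h xs | em {P = ∃ (W x)}
    ... | h′ , extends | no ∄y = h′ , λ
      { (here refl) w → contradiction (_ , w) ∄y
      ; (there x∈) w → extends x∈ w }
    ... | h′ , extends | yes (y , wxy) = ↔-trans h′ (transpose (to x) y) , λ
      { (here refl) w → trans (transposeAt-left (to x) y) (functional wxy w)
      ; (there x∈) w → preserved x∈ w }
      where
      open Inverse h′ using (to; from; strictlyInverseʳ)

      preserved : ∀ {x′ y′} → x′ ∈ xs → W x′ y′ → transposeAt (to x) y (to x′) ≡ y′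
      preserved {x′} {y′} x∈ w with em {P = x′ ≡ x}
      ... | yes refl = trans (transposeAt-left (to x) y) (functional wxy w)
      ... | no x′≢x  = trans (transposeAt-other
        (λ eq → x′≢x (trans (sym (strictlyInverseʳ x′))
                        (trans (cong from eq) (strictlyInverseʳ x))))
        (λ eq → x′≢x (injective w (subst (W x) (trans (sym eq) (extends x∈ w)) wxy))))
        (extends x∈ w)

  module _ {X : Set a} {Y : Set b} (V : X → Y → Set p)
           (functional : ∀ {x y z} → V x y → V x z → y ≡ z) where

    -- Functionality makes one value per element of `xs` enough, and excluded middle decides whether
    -- there is one.
    image : (xs : List X) → Σ[ ys ∈ List Y ] (∀ {x y} → x ∈ xs → V x y → y ∈ ys)
    image []       = [] , λ ()
    image (x ∷ xs) with image xs | em {P = ∃ (V x)}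
    ... | ys , covers | no ∄y = ys , λ
      { (here refl) v → contradiction (_ , v) ∄y
      ; (there x∈) v → covers x∈ v }
    ... | ys , covers | yes (y , vxy) = y ∷ ys , λ
      { (here refl) v → here (functional v vxy)
      ; (there x∈) v → there (covers x∈ v) }

  -- Totality of the saturation.

  module _ {f : A → A} {G : A → A → Set p} {M : A → A → Set q}
           (P : PartialIso f G) (match : Matching f G M) where

    private
      module P = PartialIso P
      module M = Matching match

    -- Induction on the number of steps after which `x` enters the domain of `G`: once `f x` has a
    -- partner `y`, the matching chooses a partner of `x` among the preimages of `y`.
    saturated-total : ∀ n {x} → ∃ (G (iterate f x n)) → ∃ (Saturated f G M x)
    saturated-total n {x} hits with em {P = ∃ (G x)}
    saturated-total n       hits       | yes (y , g) = y , base g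
    saturated-total zero    hits       | no ∉dom = contradiction hits ∉dom
    saturated-total (suc n) {x} (w , g) | no ∉dom =
      let y , e      = saturated-total n (w , g)
          z , eq , m = M.total ¬px (saturated-similar P match e)
          e′         = subst (Saturated f G M (f x)) (sym eq) e
      in z , step e′ ∉dom (∉cod e′ m) m
      where
      -- A periodic `x` would be an iterate of an element of the domain of `G`, hence in the domain
      -- itself.
      ¬px : ¬ Periodic f x
      ¬px px = let k , eq = return f px (suc n) in
        ∉dom (_ , subst (λ v → G v (iterate f w k)) eq (P.iterated g k))

      -- If `G v z`, then `M v z` as well, because the matching extends `G`. Since `f v` and `f x`
      -- have the same partner `f z`, they are equal, and injectivity of `M` gives `v ≡ x`.
      ∉cod : ∀ {z} → Saturated f G M (f x) (f z) → M x z → ¬ ∃ (flip G z)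
      ∉cod {z} e m (v , g) = ∉dom (z , subst (λ v → G v z) v≡x g)
        where
        ¬pz : ¬ Periodic f z
        ¬pz = proj₂ (M.nonperiodic m)

        v≡x : v ≡ x
        v≡x = M.injective
          (M.extends g (¬pz ∘ similar-periodic (P.similar g)) ¬pz) m
          (PartialIso.injective (saturated P match) (base (P.closed g)) e)

  -- Homogeneous algebras and their matchings.

  freshPreimage-irrelevant : ∀ {f : A → A} {x y} (p q : FreshPreimage f x y) → p ≡ q
  freshPreimage-irrelevant (refl , ¬p) (refl , ¬q) = cong (refl ,_) (ext λ p → contradiction p ¬p)

  freshPreimage-≡ : ∀ {f : A → A} {x} {y z : ∃ (FreshPreimage f x)} → proj₁ y ≡ proj₁ z → y ≡ z
  freshPreimage-≡ refl = cong (_ ,_) (freshPreimage-irrelevant _ _)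

  -- Since `y` and `h y` are similar, `h` preserves and reflects periodicity; `pullback` supplies
  -- surjectivity onto the preimages of `h x`.
  fresh-embedding : {f : A → A} {g : B → B} (h : A → B) → (∀ x → h (f x) ≡ g (h x)) →
                    (∀ {x y} → h x ≡ h y → x ≡ y) → ∀ x → (∀ z → g z ≡ h x → ∃[ y ] h y ≡ z) →
                    ∃ (FreshPreimage f x) ↔ ∃ (FreshPreimage g (h x))
  fresh-embedding {f = f} {g} h homo inj x pullback = mk↔ₛ′
    (λ (y , fy≡x , ¬py) → h y , trans (sym (homo y)) (cong h fy≡x) ,
       ¬py ∘ similar-periodic (similar-sym (embed y)))
    (λ (z , gz≡hx , ¬pz) → let y , hy≡z = pullback z gz≡hx in
       y , inj (trans (homo y) (trans (cong g hy≡z) gz≡hx)) ,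
       ¬pz ∘ subst (Periodic g) hy≡z ∘ similar-periodic (embed y))
    (λ (z , gz≡hx , _) → freshPreimage-≡ (proj₂ (pullback z gz≡hx)))
    (λ (y , _) → freshPreimage-≡ (inj (proj₂ (pullback (h y) _))))
    where
    embed : ∀ y → Similar f g y (h y)
    embed = similar-embedding h homo inj

  Homogeneous : {A : Set a} → (A → A) → Set a
  Homogeneous f = ∀ x y → Similar f f x y → ∃ (FreshPreimage f x) ↔ ∃ (FreshPreimage f y)

  module _ {f : A → A} {G : A → A → Set p} (P : PartialIso f G)
           (gens : List A)
           (generated : ∀ {x y} → G x y → ∃[ g ] g ∈ gens × ∃[ n ] iterate f g n ≡ x)
           (homogeneous : Homogeneous f)
           where

    private
      module P = PartialIso P

      W : ∀ {x y} → ∃ (FreshPreimage f x) → ∃ (FreshPreimage f y) → Set _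
      W (u , _) (v , _) = G u v

      -- By `orbit-preimage-unique`, relating a generator to the nonperiodic preimages of `x` on its
      -- orbit is functional, so the image of `gens` is a finite list of them all.
      preimagesInDomain : ∀ x → Σ[ us ∈ List (∃ (FreshPreimage f x)) ]
        (∀ {g} {u : ∃ (FreshPreimage f x)} → g ∈ gens → ∃[ n ] iterate f g n ≡ proj₁ u → u ∈ us)
      preimagesInDomain x = image (λ g u → ∃[ n ] iterate f g n ≡ proj₁ u)
        (λ { {g} {_ , fu , ¬pu} {_ , fv , ¬pv} (m , refl) (n , refl) →
             freshPreimage-≡ (orbit-preimage-unique f g {m} {n} (trans fu (sym fv)) ¬pu ¬pv) })
        gens

      -- Recomputing s makes the bijection independent of the proof of similarity.
      matchAt : ∀ x y → Similar f f x y →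
        Σ[ h ∈ ∃ (FreshPreimage f x) ↔ ∃ (FreshPreimage f y) ]
          (∀ {u v} → u ∈ proj₁ (preimagesInDomain x) → W u v → Inverse.to h u ≡ v)
      matchAt x y s = extendInjection W
        (λ g h → freshPreimage-≡ (P.functional g h))
        (λ g h → freshPreimage-≡ (P.injective g h))
        (homogeneous x y (recompute em s)) (proj₁ (preimagesInDomain x))

      -- The targets `x` and `y` are separate variables, not `f u` and `f v`: totality and
      -- cototality each produce an end whose target is known only up to a propositional equation.
      Match : A → A → Set _
      Match u v = Σ[ x ∈ A ] Σ[ y ∈ A ] Σ[ s ∈ Similar f f x y ]
        Σ[ u∈ ∈ FreshPreimage f x u ] Σ[ v∈ ∈ FreshPreimage f y v ]
          Inverse.to (proj₁ (matchAt x y s)) (u , u∈) ≡ (v , v∈)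

      matchAt-constant : ∀ {x y} s t → matchAt x y s ≡ matchAt x y t
      matchAt-constant s t = cong
        (λ r → extendInjection W (λ g h → freshPreimage-≡ (P.functional g h))
          (λ g h → freshPreimage-≡ (P.injective g h)) (homogeneous _ _ r) _)
        (recompute-constant em s t)

      match-functional : ∀ {u v w} → Match u v → Match u w → f v ≡ f w → v ≡ w
      match-functional (x , y , s , (fu , _) , (fv , _) , eq) (x′ , y′ , s′ , (fu′ , _) , (fw , _) , eq′) fv≡fw
        with trans (sym fu) fu′ | trans (sym fv) (trans fv≡fw fw)
      ... | refl | refl = cong proj₁
        (trans (sym eq) (trans (cong (λ h → Inverse.to (proj₁ h) _) (matchAt-constant s s′))
          (trans (cong (Inverse.to (proj₁ (matchAt x y s′))) (freshPreimage-≡ refl)) eq′)))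

      match-injective : ∀ {u v w} → Match u w → Match v w → f u ≡ f v → u ≡ v
      match-injective (x , y , s , (fu , _) , (fw , _) , eq) (x′ , y′ , s′ , (fv , _) , (fw′ , _) , eq′) fu≡fv
        with trans (sym fu) (trans fu≡fv fv) | trans (sym fw) fw′
      ... | refl | refl = cong proj₁
        (trans (sym (Inverse.strictlyInverseʳ h _))
          (trans (cong (Inverse.from h)
            (trans eq (trans (freshPreimage-≡ refl)
              (trans (sym eq′) (cong (λ h → Inverse.to (proj₁ h) _) (matchAt-constant s′ s))))))
          (Inverse.strictlyInverseʳ h _)))
        where h = proj₁ (matchAt x y s)

    matching : ∃[ M ] Matching {q = _} f G M
    matching = Match , record
      { total       = λ {x} {y} ¬px s →
          let z , fz , ¬pz = Inverse.to (proj₁ (matchAt (f x) y s)) (x , refl , ¬px)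
          in z , fz , f x , y , s , (refl , ¬px) , (fz , ¬pz) , refl
      ; cototal     = λ {x} {y} ¬py s →
          let h            = proj₁ (matchAt x (f y) (similar-sym s))
              z , fz , ¬pz = Inverse.from h (y , refl , ¬py)
          in z , fz , x , f y , similar-sym s , (fz , ¬pz) , (refl , ¬py) , Inverse.strictlyInverseˡ h _
      ; functional  = match-functional
      ; injective   = match-injective
      ; nonperiodic = λ (_ , _ , _ , (_ , ¬pu) , (_ , ¬pv) , _) → ¬pu , ¬pv
      ; extends     = λ {x} {y} g ¬px ¬py →
          -- The element lies in the domain of `G`, hence on the orbit of a generator, hence in the
          -- finite list on which the chosen bijection agrees with `G`.
          let h , h-extends = matchAt (f x) (f y) (P.similar (P.closed g))
              _ , g∈ , orbit = generated g
          in f x , f y , P.similar (P.closed g) , (refl , ¬px) , (refl , ¬py) ,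
             h-extends (proj₂ (preimagesInDomain (f x)) g∈ orbit) g
      }

  -- Extending an isomorphism between subalgebras of a sum.

  module _ (γ : Maybe ℕ → Set ℓ) (𝓓 : Maybe ℕ → MonounaryAlgebra ℓ)
           (connected : ∀ κ → Connected (𝓓 κ))
           (separated : ∀ {κ κ′ x y} →
             Similar (MonounaryAlgebra.θ (𝓓 κ)) (MonounaryAlgebra.θ (𝓓 κ′)) x y → κ ≡ κ′)
           (homogeneous : ∀ κ → Homogeneous (MonounaryAlgebra.θ (𝓓 κ)))
           where

    private
      module 𝓓 (κ : Maybe ℕ) = MonounaryAlgebra (𝓓 κ)

      S : Unary ℓ
      S = ∑ λ κ → γ κ · 𝓓.unary κ

      open Unary S using (Carrier; θ)

      embed : ∀ κ → γ κ → 𝓓.Carrier κ → Carrier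
      embed κ i x = κ , i , x

      embed-injective : ∀ {κ i x y} → embed κ i x ≡ embed κ i y → x ≡ y
      embed-injective refl = refl

      iterate-embed : ∀ κ i x n → embed κ i (iterate (𝓓.θ κ) x n) ≡ iterate θ (embed κ i x) n
      iterate-embed κ i = iterate-homo (𝓓.θ κ) θ (embed κ i) (λ _ → refl)

      similar-embed : ∀ κ i x → Similar (𝓓.θ κ) θ x (embed κ i x)
      similar-embed κ i = similar-embedding (embed κ i) (λ _ → refl) embed-injective

      similar-summands : ∀ {κ κ′ i j x y} → Similar θ θ (embed κ i x) (embed κ′ j y) →
                         Similar (𝓓.θ κ) (𝓓.θ κ′) x y
      similar-summands s = similar-trans (similar-embed _ _ _)
                             (similar-trans s (similar-sym (similar-embed _ _ _)))

      fresh-embed : ∀ κ i x → ∃ (FreshPreimage (𝓓.θ κ) x) ↔ ∃ (FreshPreimage θ (embed κ i x))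
      fresh-embed κ i x = fresh-embedding (embed κ i) (λ _ → refl) embed-injective x
        λ { (_ , _ , y) refl → y , refl }

      -- By `separated`, similar elements lie in copies of the same summand, and preimages never
      -- leave a copy.
      homogeneous-∑ : Homogeneous θ
      homogeneous-∑ (κ , i , x) (κ′ , j , y) s with separated (similar-summands s)
      ... | refl = ↔-trans (↔-sym (fresh-embed κ i x))
                     (↔-trans (homogeneous κ x y (similar-summands s)) (fresh-embed κ j y))

      OnIndices : (Carrier → Carrier → Set p) → ∀ κ → γ κ → γ κ → Set _
      OnIndices G κ i j = ∃[ x ] ∃[ y ] G (embed κ i x) (embed κ j y)

      -- Two elements of copy `i` have a common iterate because `𝓓 κ` is connected; its unique
      -- partner lies both in copy `j` and in copy `j′`.
      onIndices-functional : ∀ {G : Carrier → Carrier → Set p} → PartialIso θ G →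
        ∀ {κ i j j′} → OnIndices G κ i j → OnIndices G κ i j′ → j ≡ j′
      onIndices-functional {G = G} P {κ} {i} {j} {j′} (x , y , g) (x′ , y′ , g′) =
        let m , n , eq = connected κ x x′ in
        index-≡ (trans (iterate-embed κ j y m) (trans
          (functional (iterated g m) (subst (λ u → G u _) (sym
            (trans (sym (iterate-embed κ i x m)) (trans (cong (embed κ i) eq) (iterate-embed κ i x′ n))))
            (iterated g′ n)))
          (sym (iterate-embed κ j′ y′ n))))
        where
        open PartialIso P
        index-≡ : ∀ {y z} → embed κ j y ≡ embed κ j′ z → j ≡ j′
        index-≡ refl = refl

    module _ {G : Carrier → Carrier → Set p} (P : PartialIso θ G) (gens : List Carrier)
             (generated : ∀ {x y} → G x y → ∃[ g ] g ∈ gens × ∃[ n ] iterate θ g n ≡ x)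
             where

      private
        module P = PartialIso P

        match = matching P gens generated homogeneous-∑

        E : Carrier → Carrier → Set _
        E = Saturated θ G (proj₁ match)

        module E = PartialIso (saturated P (proj₂ match))

        indices : ∀ κ → Σ[ is ∈ List (γ κ) ]
          (∀ {g i} → g ∈ gens → ∃[ x ] g ≡ embed κ i x → i ∈ is)
        indices κ = image (λ g i → ∃[ x ] g ≡ embed κ i x) (λ { (_ , refl) (_ , refl) → refl }) gens

        permutation : ∀ κ → Σ[ h ∈ γ κ ↔ γ κ ]
          (∀ {i j} → i ∈ proj₁ (indices κ) → OnIndices G κ i j → Inverse.to h i ≡ j)
        permutation κ = extendInjection (OnIndices G κ)
          (onIndices-functional P)
          (λ (x , y , g) (x′ , y′ , g′) → onIndices-functional (converse P) (y , x , g) (y′ , x′ , g′))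
          ↔-refl (proj₁ (indices κ))

        π π⁻¹ : ∀ κ → γ κ → γ κ
        π κ = Inverse.to (proj₁ (permutation κ))
        π⁻¹ κ = Inverse.from (proj₁ (permutation κ))

        -- Iteration does not leave a copy, so `i` is the index of some generator and belongs to the
        -- list on which `permutation` was corrected.
        π-extends : ∀ {κ i j} → OnIndices G κ i j → π κ i ≡ j
        π-extends {κ} {i} (x , y , g) with generated g
        ... | (κ′ , i′ , x′) , g∈ , n , eq with trans (iterate-embed κ′ i′ x′ n) eq
        ... | refl = proj₂ (permutation κ) (proj₂ (indices κ) g∈ (x′ , refl)) (x , y , g)

        shift shift⁻¹ : Carrier → Carrier
        shift (κ , i , x) = κ , π κ i , x
        shift⁻¹ (κ , i , x) = κ , π⁻¹ κ i , x

        shift-shift⁻¹ : ∀ u → shift (shift⁻¹ u) ≡ u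
        shift-shift⁻¹ (κ , i , x) =
          cong (λ j → κ , j , x) (Inverse.strictlyInverseˡ (proj₁ (permutation κ)) i)

        shift⁻¹-shift : ∀ u → shift⁻¹ (shift u) ≡ u
        shift⁻¹-shift (κ , i , x) =
          cong (λ j → κ , j , x) (Inverse.strictlyInverseʳ (proj₁ (permutation κ)) i)

        -- These depend only on the copy containing the element, so they are invariant under `θ` by
        -- definition.
        Met CoMet : Carrier → Set _
        Met (κ , i , _) = ∃[ x ] ∃ (G (embed κ i x))
        CoMet (κ , j , _) = ∃[ y ] ∃ (flip G (embed κ j y))

        met-iterate : ∀ u n → ∃ (G (iterate θ u n)) → Met u
        met-iterate (κ , i , x) n (v , g) =
          iterate (𝓓.θ κ) x n , v , subst (λ w → G w v) (sym (iterate-embed κ i x n)) g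

        comet-iterate : ∀ v n → ∃ (flip G (iterate θ v n)) → CoMet v
        comet-iterate (κ , j , y) n (u , g) =
          iterate (𝓓.θ κ) y n , u , subst (G u) (sym (iterate-embed κ j y n)) g

        -- By connectedness `u` has an iterate in common with an element of the domain; that iterate
        -- is in the domain, so `saturated-total` applies.
        met⇒total : ∀ u → Met u → ∃ (E u)
        met⇒total (κ , i , x) (x′ , v , g) =
          let m , n , eq = connected κ x x′ in
          saturated-total P (proj₂ match) m
            (_ , subst (λ w → G w (iterate θ v n))
                   (trans (sym (iterate-embed κ i x′ n))
                     (trans (cong (embed κ i) (sym eq)) (iterate-embed κ i x m)))
                   (P.iterated g n))

        comet⇒cototal : ∀ v → CoMet v → ∃ (flip E v)
        comet⇒cototal (κ , j , y) (y′ , u , g) =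
          let m , n , eq = connected κ y y′
              w , e = saturated-total (converse P) (reverse (proj₂ match)) m
                (_ , subst (G (iterate θ u n))
                       (trans (sym (iterate-embed κ j y′ n))
                         (trans (cong (embed κ j) (sym eq)) (iterate-embed κ j y m)))
                       (P.iterated g n))
          in w , saturated-flip e

        total⇒met : ∀ {u v} → E u v → Met u
        total⇒met {u} e = let n , hits = enters e in met-iterate u n hits
          where
          enters : ∀ {u v} → E u v → ∃[ n ] ∃ (G (iterate θ u n))
          enters (base g)       = 0 , _ , g
          enters (step e _ _ _) = let n , hits = enters e in suc n , hits

        cototal⇒comet : ∀ {u v} → E u v → CoMet v
        cototal⇒comet {v = v} e = let n , hits = enters e in comet-iterate v n hits
          where
          enters : ∀ {u v} → E u v → ∃[ n ] ∃ (flip G (iterate θ v n))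
          enters (base g)       = 0 , _ , g
          enters (step e _ _ _) = let n , hits = enters e in suc n , hits

        -- Elements paired by `G` are similar, so by `separated` the partner lies in a copy of the
        -- same kind, and `π-extends` identifies its index.
        comet⇒met : ∀ v → CoMet v → Met (shift⁻¹ v)
        comet⇒met (κ , j , _) (y , (κ′ , i , x) , g) with separated (similar-summands (P.similar g))
        ... | refl = x , _ , subst (λ i → G (embed κ i x) (embed κ j y))
          (trans (sym (Inverse.strictlyInverseʳ (proj₁ (permutation κ)) i))
            (cong (π⁻¹ κ) (π-extends (x , y , g)))) g

        comet-shift⇒met : ∀ u → CoMet (shift u) → Met u
        comet-shift⇒met u comet = subst Met (shift⁻¹-shift u) (comet⇒met (shift u) comet)

        -- E is defined on the components that meet the domain of G; the others are
        -- moved identically along the permutation of indices.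
        F : Carrier → Carrier → Set _
        F u v = E u v ⊎ (¬ Met u × shift u ≡ v)

        F-partialIso : PartialIso θ F
        F-partialIso = record
          { functional = λ
              { (inj₁ d) (inj₁ e) → E.functional d e
              ; (inj₁ d) (inj₂ (unmet , _)) → contradiction (total⇒met d) unmet
              ; (inj₂ (unmet , _)) (inj₁ e) → contradiction (total⇒met e) unmet
              ; (inj₂ (_ , eq)) (inj₂ (_ , eq′)) → trans (sym eq) eq′ }
          ; injective = λ
              { (inj₁ d) (inj₁ e) → E.injective d e
              -- The ranges of the two parts of `F` are disjoint: a copy that meets the range of `G`
              -- is the shift of one that meets its domain.
              ; {y = u′} (inj₁ d) (inj₂ (unmet , refl)) → contradiction (comet-shift⇒met u′ (cototal⇒comet d)) unmet
              ; {x = u′} (inj₂ (unmet , refl)) (inj₁ e) → contradiction (comet-shift⇒met u′ (cototal⇒comet e)) unmet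
              ; (inj₂ (_ , eq)) (inj₂ (_ , eq′)) →
                  trans (sym (shift⁻¹-shift _)) (trans (cong shift⁻¹ (trans eq (sym eq′))) (shift⁻¹-shift _)) }
          ; closed = λ
              { (inj₁ e) → inj₁ (E.closed e)
              ; (inj₂ (unmet , eq)) → inj₂ (unmet , cong θ eq) }
          }

        F-total : ∀ u → ∃ (F u)
        F-total u with em {P = Met u}
        ... | yes met  = let v , e = met⇒total u met in v , inj₁ e
        ... | no unmet = shift u , inj₂ (unmet , refl)

        F-cototal : ∀ v → ∃ (flip F v)
        F-cototal v with em {P = CoMet v} | em {P = Met (shift⁻¹ v)}
        ... | yes comet | _        = let u , e = comet⇒cototal v comet in u , inj₁ e
        ... | no _      | no unmet = shift⁻¹ v , inj₂ (unmet , shift-shift⁻¹ v)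
        -- This case is impossible: `G` takes the copy of `shift⁻¹ v` to its shift, the copy of `v`,
        -- which would then meet the range.
        ... | no uncomet | yes (x , (κ′ , j , y) , g) with separated (similar-summands (P.similar g))
        ... | refl = contradiction (y , _ , subst (λ j → G _ (embed _ j y))
                       (trans (sym (π-extends (x , y , g)))
                         (Inverse.strictlyInverseˡ (proj₁ (permutation _)) _)) g) uncomet

      extendToAutomorphism : Σ[ g ∈ S ≅ S ] (∀ {u v} → G u v → _≅_.to g u ≡ v)
      extendToAutomorphism = let g , graph = graph⇒≅ F-partialIso F-total F-cototal in
        g , λ h → graph (inj₁ (base h))

  -- Sums of the stated form are ultrahomogeneous.

  least : (P : ℕ → Set p) → ∃ P → ∃[ k ] P k × (∀ j → j < k → ¬ P j)
  least {p} P (n , pₙ) = search P n pₙ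
    where
    search : (P : ℕ → Set p) → ∀ n → P n → ∃[ k ] P k × (∀ j → j < k → ¬ P j)
    search P zero    pₙ = 0 , pₙ , λ _ ()
    search P (suc n) pₙ with em {P = P 0}
    ... | yes p₀ = 0 , p₀ , λ _ ()
    ... | no ¬p₀ = let k , pₖ , minimal = search (P ∘ suc) n pₙ in
      suc k , pₖ , λ { zero _ → ¬p₀ ; (suc j) (s≤s j<k) → minimal j j<k }

  module _ {n : ℕ → ℕ} {α : NonzeroCardinal ℓ} {αs : ℕ → CardinalList ℓ}
           {𝓑 : MonounaryAlgebra ℓ} {𝓒 : ℕ → MonounaryAlgebra ℓ}
           (n≢0 : ∀ k → NonZero (n k)) (n-injective : Injective _≡_ _≡_ n)
           (is𝓑 : Is𝓑 α 𝓑) (is𝓐 : ∀ k → Is𝓐[ n k ⨾ αs k ] (𝓒 k)) where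

    private
      𝓓 : Maybe ℕ → MonounaryAlgebra ℓ
      𝓓 = maybe 𝓒 𝓑

      module 𝓓 (κ : Maybe ℕ) = MonounaryAlgebra (𝓓 κ)

      connected : ∀ κ → Connected (𝓓 κ)
      connected nothing  = Is𝓑.connected is𝓑
      connected (just k) = Is𝓐[_⨾_].connected (is𝓐 k)

      eventuallyPeriodic : ∀ k x → ∃[ h ] Periodic (𝓓.θ (just k)) (iterate (𝓓.θ (just k)) x h)
      eventuallyPeriodic k = 𝓐-eventuallyPeriodic {{n≢0 k}} (is𝓐 k)

      ¬similar : ∀ {k x y} → ¬ Similar (𝓓.θ (just k)) (𝓓.θ nothing) x y
      ¬similar {k} {x} s = let h , periodic = eventuallyPeriodic k x in
        Is𝓑.acyclic is𝓑 _ (similar-periodic (similar-iterate s h) periodic)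

      -- Similarity would carry a periodic iterate from `𝓒 k` to the acyclic `𝓑`. Between `𝓒 k` and
      -- `𝓒 k′` it forces equal cycle lengths, by two inequalities.
      separated : ∀ {κ κ′ x y} → Similar (𝓓.θ κ) (𝓓.θ κ′) x y → κ ≡ κ′
      separated {nothing} {nothing} s = refl
      separated {nothing} {just k}  s = contradiction (similar-sym s) ¬similar
      separated {just k}  {nothing} s = contradiction s ¬similar
      separated {just k}  {just k′} s = cong just (n-injective (ℕ.≤-antisym
        (length-≤ s) (length-≤ (similar-sym s))))
        where
        length-≤ : ∀ {k k′ x y} → Similar (𝓓.θ (just k)) (𝓓.θ (just k′)) x y → n k ≤ n k′
        length-≤ {k} {k′} {x} s = cycleLength-≤ (𝓒 k) (𝓒 k′)
          (Is𝓐[_⨾_].connected (is𝓐 k)) (Is𝓐[_⨾_].cycle (is𝓐 k)) (Is𝓐[_⨾_].cycle (is𝓐 k′))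
          (eventuallyPeriodic k x) s

      equinumerous : ∀ {f : A → A} {x y} {κ : Set b} →
        HasCardinality (FreshPreimage f x) κ → HasCardinality (FreshPreimage f y) κ →
        ∃ (FreshPreimage f x) ↔ ∃ (FreshPreimage f y)
      equinumerous h h′ = ↔-trans (hasCardinality⇒↔ freshPreimage-irrelevant h)
                            (↔-sym (hasCardinality⇒↔ freshPreimage-irrelevant h′))

      -- In `𝓑` all counts agree. In `𝓒 k` similar elements have the same finite height, which
      -- determines the count.
      homogeneous : ∀ κ → Homogeneous (𝓓.θ κ)
      homogeneous nothing  x y s = equinumerous (𝓑-fresh is𝓑 x) (𝓑-fresh is𝓑 y)
      homogeneous (just k) x y s =
        let h , ht = least _ (eventuallyPeriodic k x) in
        equinumerous (𝓐-fresh (is𝓐 k) ht) (𝓐-fresh (is𝓐 k) (similar-height s ht))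

    sum-ultrahomogeneous : ∀ {𝓐 : MonounaryAlgebra ℓ} (γ : Maybe ℕ → Set ℓ) →
      MonounaryAlgebra.unary 𝓐 ≅ ∑ (λ κ → γ κ · 𝓓.unary κ) → Ultrahomogeneous 𝓐
    sum-ultrahomogeneous {𝓐} γ φ S T (gs , S⊆gs , _) _ f =
      ≅-trans φ (≅-trans g (≅-sym φ)) ,
      λ s → trans (cong φ.from (g-extends (s , sym (φ.strictlyInverseʳ _) , sym (φ.strictlyInverseʳ _))))
                  (φ.strictlyInverseʳ _)
      where
      module 𝓐 = MonounaryAlgebra 𝓐
      module f where
        open SubalgebraIsomorphism f public using (commutes)
        open Inverse (SubalgebraIsomorphism.bijection f) public
      module φ where
        open _≅_ φ public using (commutes)
        open Inverse (_≅_.bijection φ) public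

      -- The isomorphism `f`, transported along `φ`; only the underlying element of `s` is compared,
      -- whatever its proof of membership.
      G : Unary.Carrier (∑ (λ κ → γ κ · 𝓓.unary κ)) → Unary.Carrier (∑ (λ κ → γ κ · 𝓓.unary κ)) → Set _
      G u v = ∃[ s ] proj₁ s ≡ φ.from u × proj₁ (f.to s) ≡ φ.from v

      from-injective : ∀ {u v} → φ.from u ≡ φ.from v → u ≡ v
      from-injective eq = trans (sym (φ.strictlyInverseˡ _)) (trans (cong φ.to eq) (φ.strictlyInverseˡ _))

      G-partialIso : PartialIso _ G
      G-partialIso = record
        { functional = λ (s , eq , eq′) (t , eq″ , eq‴) →
            from-injective (trans (sym eq′) (trans (f.to-cong (trans eq (sym eq″))) eq‴))
        ; injective  = λ (s , eq , eq′) (t , eq″ , eq‴) →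
            from-injective (trans (sym eq) (trans (trans (sym (f.strictlyInverseʳ s))
              (trans (f.from-cong (trans eq′ (sym eq‴))) (f.strictlyInverseʳ t))) eq″))
        ; closed     = λ (s , eq , eq′) → Subalgebra.restrict S s ,
            trans (cong 𝓐.θ eq) (sym (_≅_.commutes (≅-sym φ) _)) ,
            trans (f.commutes s) (trans (cong 𝓐.θ eq′) (sym (_≅_.commutes (≅-sym φ) _)))
        }

      extension = extendToAutomorphism γ 𝓓 connected separated homogeneous G-partialIso (map φ.to gs)
        λ { (s , eq , _) →
            let g , g∈ , n , orbit = orbit-generator (S⊆gs (proj₂ s))
            in φ.to g , ∈-map⁺ φ.to g∈ , n ,
               trans (sym (iterate-homo 𝓐.θ _ φ.to φ.commutes g n))
                 (trans (cong φ.to (trans orbit eq)) (φ.strictlyInverseˡ _)) }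

      g = proj₁ extension
      g-extends = proj₂ extension

  -- Cardinal lists and the recognition of components.

  finiteList : (κ : ℕ → Set ℓ) → ∀ h → (∀ k → k < h → κ k) → List (NonzeroCardinal ℓ)
  finiteList κ zero    nonzero = []
  finiteList κ (suc h) nonzero =
    (κ 0 , nonzero 0 (s≤s z≤n)) ∷ finiteList (κ ∘ suc) h (λ k k<h → nonzero (suc k) (s≤s k<h))

  entry-finiteList : (κ : ℕ → Set ℓ) → ∀ h (nonzero : ∀ k → k < h → κ k) → (∀ k → h ≤ k → ¬ κ k) →
                     ∀ k → entry (finite (finiteList κ h nonzero)) k ↔ κ k
  entry-finiteList κ zero    nonzero zeros k       = ¬⇒↔⊥ (zeros k z≤n)
  entry-finiteList κ (suc h) nonzero zeros zero    = ↔-refl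
  entry-finiteList κ (suc h) nonzero zeros (suc k) =
    entry-finiteList (κ ∘ suc) h _ (λ k h≤k → zeros (suc k) (s≤s h≤k)) k

  -- By `down` the nonzero values form an initial segment: the list is infinite if it is everything,
  -- and otherwise stops at the first zero.
  cardinalList : (κ : ℕ → Set ℓ) → (∀ k → κ (suc k) → κ k) →
                 Σ[ αs ∈ CardinalList ℓ ] (∀ k → entry αs k ↔ κ k)
  cardinalList κ down with em {P = ∃[ k ] ¬ κ k}
  ... | no ∄zero = infinite (λ k → κ k , nonzero k) , λ k → ↔-refl
    where
    nonzero : ∀ k → κ k
    nonzero k with em {P = κ k}
    ... | yes x = x
    ... | no ¬x = contradiction (k , ¬x) ∄zero
  ... | yes ∃zero with least _ ∃zero
  ...   | h , ¬x , minimal = finite (finiteList κ h nonzero) , entry-finiteList κ h nonzero zeros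
    where
    nonzero : ∀ k → k < h → κ k
    nonzero k k<h with em {P = κ k}
    ... | yes x = x
    ... | no ¬x = contradiction ¬x (minimal k k<h)

    zeros : ∀ k → h ≤ k → ¬ κ k
    zeros k h≤k x = ¬x (descend (ℕ.≤⇒≤′ h≤k) x)
      where
      descend : ∀ {k} → h ℕ.≤′ k → κ k → κ h
      descend (ℕ.≤′-reflexive refl) x = x
      descend (ℕ.≤′-step h≤k)       x = descend h≤k (down _ x)

  module _ (𝓒 : MonounaryAlgebra ℓ) (connected : Connected 𝓒)
           (homogeneous : Homogeneous (MonounaryAlgebra.θ 𝓒)) where
    open MonounaryAlgebra 𝓒

    -- Without cycles any two elements are similar, so all have as many preimages as `θ nonempty`,
    -- which has at least the preimage `nonempty`.
    homogeneous⇒Is𝓑 : (∀ x → ¬ Cyclic 𝓒 x) → ∃[ α ] Is𝓑 α 𝓒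
    homogeneous⇒Is𝓑 acyclic =
      (∃ (FreshPreimage θ (θ nonempty)) , nonempty , refl , acyclic _) , record
        { connected = connected
        ; acyclic   = acyclic
        ; preimages = λ x → hasCardinality-≐ (swap (preimage≐fresh {𝓒 = 𝓒} (acyclic x)))
            (↔⇒hasCardinality freshPreimage-irrelevant
              (homogeneous x (θ nonempty) (neverPeriodic-similar (λ _ → acyclic _) (λ _ → acyclic _))))
        }

    private
      -- The count is taken at an arbitrary element of height `k`; at heights that do not occur, the
      -- default `⊥` lets the list end.
      freshCount : ℕ → Set ℓ
      freshCount k with em {P = ∃[ x ] Height θ x k}
      ... | yes (x , _) = ∃ (FreshPreimage θ x)
      ... | no _        = ⊥

      freshCount-height : ∀ {x} k → Height θ x k → freshCount k ↔ ∃ (FreshPreimage θ x)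
      freshCount-height {x} k ht with em {P = ∃[ x ] Height θ x k}
      ... | yes (y , ht′) = homogeneous y x (height-similar 𝓒 connected k ht′ ht)
      ... | no ∄x         = contradiction (x , ht) ∄x

      -- A nonzero count at `k + 1` comes from an element `x` of that height, and `x` is itself a
      -- nonperiodic preimage of `θ x`, of height `k`.
      freshCount-down : ∀ k → freshCount (suc k) → freshCount k
      freshCount-down k y with em {P = ∃[ x ] Height θ x (suc k)}
      freshCount-down k _ | yes (x , px , below) = Inverse.from
        (freshCount-height {θ x} k (px , λ j j<k → below (suc j) (s≤s j<k)))
        (x , refl , below 0 (s≤s z≤n))
      freshCount-down k () | no _

    homogeneous⇒Is𝓐 : ∀ {c k} → Period θ c k → ∃[ αs ] Is𝓐[ suc k ⨾ αs ] 𝓒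
    homogeneous⇒Is𝓐 period =
      let αs , entries = cardinalList freshCount freshCount-down
          card : ∀ x k → Height θ x k → HasCardinality (FreshPreimage θ x) (entry αs k)
          card x k ht = ↔⇒hasCardinality freshPreimage-irrelevant
            (↔-sym (↔-trans (entries k) (freshCount-height k ht)))
      in αs , record
        { connected       = connected
        ; cycle           = period⇒cycle 𝓒 connected period
        ; cyclicPreimages = λ c periodic → card c 0 (periodic , λ _ ())
        ; preimages       = λ x k ht → hasCardinality-≐ (swap (preimage≐fresh {𝓒 = 𝓒} (proj₂ ht 0 (s≤s z≤n))))
                              (card x (suc k) ht)
        }

  does⇒ : ∀ {P : Set p} → does (em {P = P}) ≡ true → P
  does⇒ {P = P} eq with em {P = P}
  does⇒ eq | yes x = x

  ⇒does : ∀ {P : Set p} → P → does (em {P = P}) ≡ true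
  ⇒does {P = P} x with em {P = P}
  ... | yes _ = refl
  ... | no ¬x = contradiction x ¬x

  -- Decomposition of an ultrahomogeneous algebra.

  module _ (𝓐 : MonounaryAlgebra ℓ) where
    open MonounaryAlgebra 𝓐

    infix 4 _∼_
    _∼_ : Carrier → Carrier → Set ℓ
    x ∼ y = ∃[ m ] ∃[ n ] iterate θ x m ≡ iterate θ y n

    ∼-refl : ∀ {x} → x ∼ x
    ∼-refl = 0 , 0 , refl

    ∼-sym : ∀ {x y} → x ∼ y → y ∼ x
    ∼-sym (m , n , eq) = n , m , sym eq

    ∼-trans : ∀ {x y z} → x ∼ y → y ∼ z → x ∼ z
    ∼-trans {x} {y} {z} (m , n , eq) (m′ , n′ , eq′) = m ℕ.+ m′ , n′ ℕ.+ n , (begin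
      iterate θ x (m ℕ.+ m′)           ≡⟨ iterate-+ θ x m m′ ⟩
      iterate θ (iterate θ x m) m′     ≡⟨ cong (λ u → iterate θ u m′) eq ⟩
      iterate θ (iterate θ y n) m′     ≡⟨ iterate-comm θ y n m′ ⟩
      iterate θ (iterate θ y m′) n     ≡⟨ cong (λ u → iterate θ u n) eq′ ⟩
      iterate θ (iterate θ z n′) n     ≡⟨ iterate-+ θ z n′ n ⟨
      iterate θ z (n′ ℕ.+ n)           ∎)
      where open ≡-Reasoning

    ∼-θ : ∀ {x} → θ x ∼ x
    ∼-θ = 0 , 1 , refl

    -- The iterates that follow a periodic iterate of `y` are periodic too, and eventually they are
    -- iterates of `x`.
    ∼-neverPeriodic : ∀ {x y} → x ∼ y → NeverPeriodic θ x → NeverPeriodic θ y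
    ∼-neverPeriodic {x} {y} (m , n , eq) never k periodic = never (m ℕ.+ k)
      (subst (Periodic θ)
        (trans (iterate-comm θ y k n) (trans (cong (λ z → iterate θ z k) (sym eq)) (sym (iterate-+ θ x m k))))
        (periodic-iterate θ n periodic))

    -- A representative must lie on the cycle if its component has one; then its kind alone
    -- determines its similarity type.
    Root : Carrier → Set ℓ
    Root r = Periodic θ r ⊎ NeverPeriodic θ r

    root-exists : ∀ x → ∃[ r ] x ∼ r × Root r
    root-exists x with em {P = ∃[ n ] Periodic θ (iterate θ x n)}
    ... | yes (n , periodic) = iterate θ x n , (n , 0 , refl) , inj₁ periodic
    ... | no never           = x , ∼-refl , inj₂ λ n periodic → never (n , periodic)

    -- Since ∼-related elements have equal characteristic functions, choosing from
    -- those functions gives a root that depends only on the component.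
    choose : (Carrier → Bool) → Carrier
    choose χ with em {P = ∃[ x ] χ x ≡ true}
    ... | yes (x , _) = x
    ... | no _        = nonempty

    choose-∈ : {χ : Carrier → Bool} → ∃[ x ] χ x ≡ true → χ (choose χ) ≡ true
    choose-∈ {χ} ∃x with em {P = ∃[ x ] χ x ≡ true}
    ... | yes (_ , eq) = eq
    ... | no ∄x        = contradiction ∃x ∄x

    root : Carrier → Carrier
    root x = choose λ r → does (em {P = x ∼ r × Root r})

    root-spec : ∀ x → x ∼ root x × Root (root x)
    root-spec x = let r , spec = root-exists x in
      does⇒ (choose-∈ {λ r → does (em {P = x ∼ r × Root r})} (r , ⇒does spec))

    root-cong : ∀ {x y} → x ∼ y → root x ≡ root y
    root-cong x∼y = cong choose (ext λ r → does-⇔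
      (mk⇔ (λ (x∼r , isRoot) → ∼-trans (∼-sym x∼y) x∼r , isRoot)
           (λ (y∼r , isRoot) → ∼-trans x∼y y∼r , isRoot)) em em)

    root-idem : ∀ x → root (root x) ≡ root x
    root-idem x = sym (root-cong (proj₁ (root-spec x)))

    ∼-root : ∀ {x y} → root x ≡ root y → x ∼ y
    ∼-root {x} {y} eq = ∼-trans (proj₁ (root-spec x))
      (subst (_∼ y) (sym eq) (∼-sym (proj₁ (root-spec y))))

    -- just k stands for a cycle of length k + 1, nothing for no cycle.
    kind : Carrier → Maybe ℕ
    kind r with em {P = Periodic θ r}
    ... | yes periodic = just (proj₁ (least _ periodic))
    ... | no _         = nothing

    HasKind : Carrier → Maybe ℕ → Set ℓ
    HasKind r nothing  = NeverPeriodic θ r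
    HasKind r (just k) = Period θ r k

    kind-spec : ∀ {r} → Root r → HasKind r (kind r)
    kind-spec {r} isRoot with em {P = Periodic θ r}
    ... | yes periodic = proj₂ (least _ periodic)
    kind-spec {r} (inj₁ periodic) | no ¬periodic = contradiction periodic ¬periodic
    kind-spec {r} (inj₂ never)    | no _         = never

    hasKind-similar : ∀ κ {r s} → HasKind r κ → HasKind s κ → Similar θ θ r s
    hasKind-similar nothing  = neverPeriodic-similar
    hasKind-similar (just k) = period-similar

    -- The condition `root r ≡ r` keeps one element of each component, so this is the number of
    -- components of kind `κ`.
    γ : Maybe ℕ → Set ℓ
    γ κ = Σ[ r ∈ Carrier ] root r ≡ r × kind r ≡ κ

    γ-hasKind : ∀ {κ} (i : γ κ) → HasKind (proj₁ i) κ
    γ-hasKind (r , eq , refl) = kind-spec (subst Root eq (proj₂ (root-spec r)))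

    component : ∀ r → root r ≡ r → MonounaryAlgebra ℓ
    component r eq = record
      { unary    = record
        { Carrier = ∃[ x ] root x ≡ r
        ; θ       = λ (x , x∈) → θ x , trans (root-cong ∼-θ) x∈
        }
      ; nonempty = r , eq
      }

    components : unary ≅ ∑ λ κ → ∑ λ ((r , eq , _) : γ κ) → MonounaryAlgebra.unary (component r eq)
    components = record
      { bijection = mk↔ₛ′ to (λ (_ , _ , x , _) → x) (λ (_ , i , x) → to-unique i x) (λ _ → refl)
      ; commutes  = λ x → to-unique (_ , root-idem x , refl) (θ x , _)
      }
      where
      Sum : Unary ℓ
      Sum = ∑ λ κ → ∑ λ ((r , eq , _) : γ κ) → MonounaryAlgebra.unary (component r eq)

      to : Carrier → Unary.Carrier Sum
      to x = kind (root x) , (root x , root-idem x , refl) , (x , refl)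

      to-unique : ∀ {κ} (i : γ κ) (x : ∃[ x ] root x ≡ proj₁ i) → to (proj₁ x) ≡ (κ , i , x)
      to-unique (_ , eq , refl) (x , refl) =
        cong (λ eq → _ , (_ , eq , refl) , (x , refl)) (≡-irrelevant (root-idem x) eq)

    module _ {r} (eq : root r ≡ r) where
      private module 𝓒 = MonounaryAlgebra (component r eq)

      proj₁-injective : {x y : 𝓒.Carrier} → proj₁ x ≡ proj₁ y → x ≡ y
      proj₁-injective refl = cong (_ ,_) (≡-irrelevant _ _)

      component-similar : ∀ x → Similar 𝓒.θ θ x (proj₁ x)
      component-similar = similar-embedding proj₁ (λ _ → refl) proj₁-injective

      component-connected : Connected (component r eq)
      component-connected (x , x∈) (y , y∈) =
        let m , n , eq′ = ∼-root (trans x∈ (sym y∈)) in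
        m , n , proj₁-injective (trans (iterate-homo 𝓒.θ θ proj₁ (λ _ → refl) _ m)
          (trans eq′ (sym (iterate-homo 𝓒.θ θ proj₁ (λ _ → refl) _ n))))

      component-homogeneous : Homogeneous θ → Homogeneous 𝓒.θ
      component-homogeneous homogeneous x y s = ↔-trans (fresh x)
        (↔-trans (homogeneous (proj₁ x) (proj₁ y)
          (similar-trans (similar-sym (component-similar x)) (similar-trans s (component-similar y))))
        (↔-sym (fresh y)))
        where
        fresh : ∀ x → ∃ (FreshPreimage 𝓒.θ x) ↔ ∃ (FreshPreimage θ (proj₁ x))
        fresh (x , x∈) = fresh-embedding proj₁ (λ _ → refl) proj₁-injective (x , x∈)
          (λ z θz≡x → (z , trans (root-cong (1 , 0 , θz≡x)) x∈) , refl)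

    Model : Maybe ℕ → MonounaryAlgebra ℓ → Set (lsuc ℓ)
    Model nothing  𝓓 = ∃[ α ] Is𝓑 α 𝓓
    Model (just k) 𝓓 = ∃[ αs ] Is𝓐[ suc k ⨾ αs ] 𝓓

    component-model : Homogeneous θ → ∀ κ ((r , eq , _) : γ κ) → Model κ (component r eq)
    component-model homogeneous nothing i@(r , eq , _) = homogeneous⇒Is𝓑 _ (component-connected eq)
      (component-homogeneous eq homogeneous)
      (λ x periodic → ∼-neverPeriodic (∼-root (trans eq (sym (proj₂ x)))) (γ-hasKind {nothing} i) 0
        (similar-periodic (component-similar eq x) periodic))
    component-model homogeneous (just k) i@(r , eq , _) = homogeneous⇒Is𝓐 _ (component-connected eq)
      (component-homogeneous eq homogeneous) {c = r , eq}
      (let period , minimal = γ-hasKind {just k} i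
           s = component-similar eq (r , eq)
       in Equivalence.from (s (suc k) 0) period ,
          λ j j<k → minimal j j<k ∘ Equivalence.to (s (suc j) 0))

    automorphism-∼ : (g : unary ≅ unary) → ∀ {x y} → x ∼ y → _≅_.to g x ∼ _≅_.to g y
    automorphism-∼ g (m , n , eq) = m , n ,
      trans (sym (iterate-homo θ θ to commutes _ m)) (trans (cong to eq) (iterate-homo θ θ to commutes _ n))
      where open _≅_ g

    component-≅ : (g : unary ≅ unary) → ∀ {r s} (eq : root r ≡ r) (eq′ : root s ≡ s) →
                  _≅_.to g r ≡ s →
                  MonounaryAlgebra.unary (component r eq) ≅ MonounaryAlgebra.unary (component s eq′)
    component-≅ g {r} {s} eq eq′ gr≡s = record
      { bijection = mk↔ₛ′
          (λ (x , x∈) → to x , maps g eq eq′ gr≡s x∈)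
          (λ (y , y∈) → from y , maps (≅-sym g) eq′ eq (trans (cong from (sym gr≡s)) (strictlyInverseʳ r)) y∈)
          (λ (y , _) → proj₁-injective eq′ (strictlyInverseˡ y))
          (λ (x , _) → proj₁-injective eq (strictlyInverseʳ x))
      ; commutes  = λ (x , _) → proj₁-injective eq′ (commutes x)
      }
      where
      open _≅_ g using (commutes)
      open Inverse (_≅_.bijection g)
      maps : (g : unary ≅ unary) → ∀ {r s x} → root r ≡ r → root s ≡ s → _≅_.to g r ≡ s →
             root x ≡ r → root (_≅_.to g x) ≡ s
      maps g eq eq′ refl x∈ = trans (root-cong (automorphism-∼ g (∼-root (trans x∈ (sym eq))))) eq′

    module _ (ultrahomogeneous : Ultrahomogeneous 𝓐) where

      orbit : Carrier → Subalgebra 𝓐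
      orbit x = record
        { member    = λ y → ∃[ n ] iterate θ x n ≡ y
        ; inhabited = x , 0 , refl
        ; closed    = λ { (n , refl) → suc n , iterate-suc θ x n }
        }

      orbit-finitelyGenerated : ∀ x → FinitelyGenerated 𝓐 (orbit x)
      orbit-finitelyGenerated x = x ∷ [] , (λ { (n , refl) → generated n }) , λ gen → generates (orbit-generator gen)
        where
        generated : ∀ n → Generated 𝓐 (x ∷ []) (iterate θ x n)
        generated zero    = generator (here refl)
        generated (suc n) = subst (Generated 𝓐 (x ∷ [])) (sym (iterate-suc θ x n)) (apply (generated n))

        generates : ∀ {y} → ∃[ g ] g ∈ x ∷ [] × ∃[ n ] iterate θ g n ≡ y → ∃[ n ] iterate θ x n ≡ y
        generates (_ , here refl , orbits) = orbits

      -- Similarity says precisely that matching the iterates of `x` with those of `y` is well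
      -- defined in both directions.
      similar⇒automorphism : ∀ {x y} → Similar θ θ x y → Σ[ g ∈ unary ≅ unary ] _≅_.to g x ≡ y
      similar⇒automorphism {x} {y} s =
        let g , extends = ultrahomogeneous (orbit x) (orbit y)
              (orbit-finitelyGenerated x) (orbit-finitelyGenerated y) f
        in g , extends (x , 0 , refl)
        where
        f : SubalgebraIsomorphism 𝓐 (orbit x) (orbit y)
        f = record
          { bijection = record
            { to        = λ (_ , n , _) → iterate θ y n , n , refl
            ; from      = λ (_ , n , _) → iterate θ x n , n , refl
            ; to-cong   = λ { {_ , m , refl} {_ , n , refl} → Equivalence.to (s m n) }
            ; from-cong = λ { {_ , m , refl} {_ , n , refl} → Equivalence.from (s m n) }
            ; inverse   = (λ { {_ , m , refl} {_ , n , refl} → Equivalence.to (s n m) })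
                        , (λ { {_ , m , refl} {_ , n , refl} → Equivalence.from (s n m) })
            }
          ; commutes  = λ { (_ , n , refl) → iterate-suc θ y n }
          }

      ultrahomogeneous⇒homogeneous : Homogeneous θ
      ultrahomogeneous⇒homogeneous x y s with similar⇒automorphism s
      ... | g , refl = fresh-embedding to commutes
        (λ eq → trans (sym (strictlyInverseʳ _)) (trans (cong from eq) (strictlyInverseʳ _))) x
        (λ z _ → from z , strictlyInverseˡ z)
        where
        open _≅_ g using (commutes)
        open Inverse (_≅_.bijection g)

      -- Any one component of kind `κ` serves for all: roots of the same kind are similar, and an
      -- automorphism carrying one root to another restricts to their components.
      model : ∀ κ → Σ[ 𝓓 ∈ MonounaryAlgebra ℓ ] Model κ 𝓓 ×
        (((r , eq , _) : γ κ) → MonounaryAlgebra.unary (component r eq) ≅ MonounaryAlgebra.unary 𝓓)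
      model κ with em {P = γ κ}
      ... | yes i@(r , eq , _) = component r eq , component-model ultrahomogeneous⇒homogeneous κ i , λ j →
        let g , gs≡r = similar⇒automorphism (hasKind-similar κ (γ-hasKind {κ} j) (γ-hasKind {κ} i))
        in component-≅ g (proj₁ (proj₂ j)) eq gs≡r
      model nothing  | no empty = successor ℓ , (_ , successor-is𝓑) , λ j → contradiction j empty
      model (just k) | no empty = rotation ℓ k , (_ , rotation-is𝓐 k) , λ j → contradiction j empty

      decomposition : unary ≅ ∑ λ κ → γ κ · MonounaryAlgebra.unary (proj₁ (model κ))
      decomposition = ≅-trans components (∑-cong λ κ → ∑-cong (proj₂ (proj₂ (model κ))))

theorem4p10 : (∀ {a} → ExcludedMiddle a) →
    (∀ {a b} → Extensionality a b) →
    ∀ {ℓ} (𝓐 : MonounaryAlgebra ℓ) →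
    Ultrahomogeneous 𝓐 ⇔
    (Σ[ n ∈ (ℕ → ℕ) ]
    Σ[ β ∈ Set ℓ ]
    Σ[ βₖ ∈ (ℕ → Set ℓ) ]
    Σ[ α ∈ NonzeroCardinal ℓ ]
    Σ[ αₖ ∈ (ℕ → CardinalList ℓ) ]
    Σ[ 𝓑 ∈ MonounaryAlgebra ℓ ]
    Σ[ 𝓒 ∈ (ℕ → MonounaryAlgebra ℓ) ]
    ((∀ k → NonZero (n k)) ×
    Injective _≡_ _≡_ n ×
    Is𝓑 α 𝓑 ×
    (∀ k → Is𝓐[ n k ⨾ αₖ k ] (𝓒 k)) ×
    MonounaryAlgebra.unary 𝓐 ≅
    β · MonounaryAlgebra.unary 𝓑 + ∑ (λ k → βₖ k · MonounaryAlgebra.unary (𝓒 k))))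
theorem4p10 em ext 𝓐 = mk⇔
  (λ ultrahomogeneous →
    let 𝓓 = model 𝓐 ultrahomogeneous
        α , is𝓑 = proj₁ (proj₂ (𝓓 nothing))
    -- The cycle lengths are `suc k`, because the kind `just k` stands for length `k + 1`; thus
    -- every positive length is listed exactly once.
    in suc , γ 𝓐 nothing , γ 𝓐 ∘ just , α , (λ k → proj₁ (proj₁ (proj₂ (𝓓 (just k))))) ,
       proj₁ (𝓓 nothing) , (λ k → proj₁ (𝓓 (just k))) ,
       _ , (λ { refl → refl }) , is𝓑 , (λ k → proj₂ (proj₁ (proj₂ (𝓓 (just k))))) ,
       ≅-trans (decomposition 𝓐 ultrahomogeneous) ∑-Maybe)
  (λ (n , β , βₖ , α , αₖ , 𝓑 , 𝓒 , n≢0 , n-injective , is𝓑 , is𝓐 , φ) →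
    sum-ultrahomogeneous n≢0 n-injective is𝓑 is𝓐 (maybe βₖ β) (≅-trans φ (≅-sym ∑-Maybe)))
  where open Classical em ext
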